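{- There exists a self-stabilizing coloring algorithm such that, for any input graph $G=(V,E)$ with $n$ vertices and maximum degree $\Delta$, it produces a proper $(\Delta+1)$-coloring of $G$ with stabilization time $O(\Delta^{3/4}\log\Delta)+\log^* n$, and every message it sends has $O(\log n)$ bits.
   Context: Model: synchronous message-passing model. The network is an undirected graph $G=(V,E)$ with $n$ vertices and maximum degree $\Delta$; each vertex hosts a processor and has a unique identifier $id(v)\in\{0,1,\dots,n-1\}$; $N(v)=\{u:(u,v)\in E\}$. In each synchronous round vertices perform local computation and exchange messages with their neighbors (a vertex may send different messages to different neighbors). A coloring $\phi:V\to Q$ is proper if $\phi(u)\ne\phi(v)$ for every edge $(u,v)$; a $(\Delta+1)$-coloring uses colors from $\{0,\dots,\Delta\}$. Self-stabilizing setting: the memory of each vertex consists of a read-only memory (ROM), which is faultless and cannot change during execution and stores hard-wired data such as $id(v)$, the parameters $n$ and $\Delta$, and the program code; and a random access memory (RAM), which stores the algorithm's mutable state. An adversary may, at any moment, inspect all memory of all vertices and change the RAM of all vertices arbitrarily. An algorithm is self-stabilizing with stabilization time $T$ if, whenever $T_0$ is the last round in which the adversary changes any vertex's RAM, it is guaranteed that by the end of round $T_0+T$ the algorithm has produced the desired output (here, a proper $(\Delta+1)$-coloring of $G$, given by the vertices' current colors). -}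

module Defs where

open import Data.Nat using (ℕ; zero; suc; _≤_; _≤?_)
open import Data.Nat.Logarithm using (⌊log₂_⌋)
open import Data.Fin using (Fin; toℕ)
open import Data.Bool using (Bool)
open import Data.List using (List)
open import Data.Product using (Σ; ∃; _×_)
open import Relation.Nullary using (yes; no)
open import Relation.Binary.PropositionalEquality using (_≡_; _≢_)

Bits : Set
Bits = List Bool

-- A simple undirected graph on vertex set Fin n (vertex v has id(v) = toℕ v),
-- presented with a port numbering: the neighbours of v are nbr v 0 .. nbr v (deg v - 1),
-- pairwise distinct, never v itself, and adjacency is symmetric (witnessed by back).
record PortGraph (n : ℕ) : Set where
  field
    deg          : Fin n → ℕ
    nbr          : (v : Fin n) → Fin (deg v) → Fin n
    nbr-injective : ∀ v (i j : Fin (deg v)) → nbr v i ≡ nbr v j → i ≡ j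
    nbr-irrefl   : ∀ v (i : Fin (deg v)) → nbr v i ≢ v
    back         : (v : Fin n) (i : Fin (deg v)) → Fin (deg (nbr v i))
    back-correct : ∀ v (i : Fin (deg v)) → nbr (nbr v i) (back v i) ≡ v

open PortGraph public

Adjacent : ∀ {n} → PortGraph n → Fin n → Fin n → Set
Adjacent G u v = ∃ λ (i : Fin (deg G u)) → nbr G u i ≡ v

HasMaxDegree : ∀ {n} → PortGraph n → ℕ → Set
HasMaxDegree G Δ = (∀ v → deg G v ≤ Δ) × (∃ λ v → deg G v ≡ Δ)

-- A deterministic synchronous algorithm.  ROM = (id, n, Δ, number of ports);
-- RAM = an arbitrary bit string.  In each round a vertex sends a message on each
-- port (depending on ROM and RAM), then updates its RAM from ROM, RAM and the
-- messages received on each port.  The current colour is read off the RAM.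
record Algorithm : Set where
  field
    send   : (id n Δ d : ℕ) → Bits → Fin d → Bits
    update : (id n Δ d : ℕ) → Bits → (Fin d → Bits) → Bits
    color  : Bits → ℕ

open Algorithm public

-- A global RAM configuration (arbitrary: chosen by the adversary).
Config : ℕ → Set
Config n = Fin n → Bits

outMsg : Algorithm → ∀ {n} → (G : PortGraph n) → ℕ → Config n → (v : Fin n) → Fin (deg G v) → Bits
outMsg A {n} G Δ cfg v i = send A (toℕ v) n Δ (deg G v) (cfg v) i

step : Algorithm → ∀ {n} → PortGraph n → ℕ → Config n → Config n
step A {n} G Δ cfg u =
  update A (toℕ u) n Δ (deg G u) (cfg u)
    (λ j → outMsg A G Δ cfg (nbr G u j) (back G u j))

run : Algorithm → ∀ {n} → PortGraph n → ℕ → ℕ → Config n → Config n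
run A G Δ zero    cfg = cfg
run A G Δ (suc t) cfg = step A G Δ (run A G Δ t cfg)

IsProperColoring : ∀ {n} → PortGraph n → ℕ → (Fin n → ℕ) → Set
IsProperColoring G Δ φ = (∀ v → φ v ≤ Δ) × (∀ u v → Adjacent G u v → φ u ≢ φ v)

logStar′ : ℕ → ℕ → ℕ
logStar′ zero    m = zero
logStar′ (suc f) m with m ≤? 1
... | yes _ = zero
... | no  _ = suc (logStar′ f ⌊log₂ m ⌋)

logStar : ℕ → ℕ
logStar n = logStar′ n n

{-# OPTIONS --safe #-}
-- Every vertex keeps a record of O(log n) bits that encodes its whole history in a synchronous colouring algorithm, and
-- recomputes it in each round from the last records of its neighbours.  A stage of the history depends only on earlier
-- stages of the neighbours, so the components of the record become stable one after the other whatever the initial RAM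
-- is, without any clock; a stable configuration is then a fixed point, about which one argues statically.
--
-- The history starts with Linial's colour reduction down to poly(Δ) colours.  All its levels are kept at once, which is
-- cheap because the number of bits at least halves from each level to the next.  Then come three passes.  A pass with
-- parameter d first sorts the uncoloured vertices into classes such that every vertex has at most d neighbours that
-- joined its class no later than itself.  The classes are then treated in turn: a vertex selects a slice of the palette
-- with more than d·O(log Δ) free colours, and takes a free colour outside the slices of those d neighbours.  Slices of
-- different vertices share only O(log Δ) colours, so this fails only if the vertex has at most d·√Δ·O(log Δ) free
-- colours, and then it has fewer uncoloured neighbours than that.  With d = Δ^(1/4), O(log Δ), 0 the uncoloured degree
-- drops to O(Δ^(3/4) log Δ), then O(√Δ log² Δ), then no uncoloured vertex is left; a pass takes O(log Δ)·degree/(d + 1)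
-- rounds.
--
-- Linial's reduction, the classes and the slices use functions [T] → [2T] that pairwise agree in few points; these are obtained greedily
-- by the method of conditional expectations, which avoids prime fields.

module Submission where

open import Defs
open import Data.Bool using (Bool; true; false; _∧_; _∨_; if_then_else_)
open import Data.Bool.Properties using (T-≡; ∨-zeroʳ)
open import Data.Fin using (Fin; toℕ)
open import Data.Fin.Properties using (toℕ-injective; toℕ<n; injective⇒≤)
open import Data.List using (List; []; _∷_; _++_; length; map; upTo; applyUpTo; allFin; cartesianProductWith; take; replicate)
open import Data.List.Membership.Propositional using (_∈_)
open import Data.List.Membership.Propositional.Properties using (∈-upTo⁺; ∈-upTo⁻; ∈-allFin; ∈-map⁺; ∈-cartesianProductWith⁺)
open import Data.List.Properties using (length-upTo; length-tabulate; length-++; length-map; length-take; take-all; ++-assoc; ++-identityʳ)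
open import Data.List.Relation.Unary.Any using (here; there)
open import Data.Nat
open import Data.Nat.DivMod using (_/_; _%_; m≡m%n+[m/n]*n; m%n<n; m/n≤m; m<n*o⇒m/o<n)
open import Data.Nat.Induction using (<-rec)
open import Data.Nat.Logarithm
open import Data.Nat.Properties
open import Data.Nat.Tactic.RingSolver using (solve)
open import Data.Product using (∃; _×_; _,_; proj₁; proj₂)
open import Data.Sum using (_⊎_; inj₁; inj₂)
open import Data.Unit using (⊤; tt)
open import Function using (_∘_; id; Equivalence)
open import Relation.Binary.Definitions using (tri<; tri≈; tri>)
open import Relation.Binary.PropositionalEquality hiding (J)
open import Relation.Nullary using (yes; no; contradiction)

private variable
  A B : Set

-- Boolean tests and sums of indicators.

χ : Bool → ℕ
χ true  = 1
χ false = 0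

∧-true⁻ : ∀ {a b} → a ∧ b ≡ true → a ≡ true × b ≡ true
∧-true⁻ {true} {true} refl = refl , refl

∧-true⁺ : ∀ {a b} → a ≡ true → b ≡ true → a ∧ b ≡ true
∧-true⁺ refl refl = refl

≡ᵇ-true⁻ : ∀ {m n} → (m ≡ᵇ n) ≡ true → m ≡ n
≡ᵇ-true⁻ {m} {n} e = ≡ᵇ⇒≡ m n (Equivalence.from T-≡ e)

≡ᵇ-true⁺ : ∀ {m n} → m ≡ n → (m ≡ᵇ n) ≡ true
≡ᵇ-true⁺ {m} {n} e = Equivalence.to T-≡ (≡⇒≡ᵇ m n e)

<ᵇ-true⁻ : ∀ {m n} → (m <ᵇ n) ≡ true → m < n
<ᵇ-true⁻ {m} {n} e = <ᵇ⇒< m n (Equivalence.from T-≡ e)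

<ᵇ-true⁺ : ∀ {m n} → m < n → (m <ᵇ n) ≡ true
<ᵇ-true⁺ e = Equivalence.to T-≡ (<⇒<ᵇ e)

<ᵇ-false⁻ : ∀ {m n} → (m <ᵇ n) ≡ false → n ≤ m
<ᵇ-false⁻ e = ≮⇒≥ λ m<n → contradiction (trans (sym (<ᵇ-true⁺ m<n)) e) λ ()

<ᵇ-false⁺ : ∀ {m n} → n ≤ m → (m <ᵇ n) ≡ false
<ᵇ-false⁺ {m} {n} n≤m with m <ᵇ n in e
... | true  = contradiction (<ᵇ-true⁻ {m} e) (≤⇒≯ n≤m)
... | false = refl

≤ᵇ-true⁻ : ∀ {m n} → (m ≤ᵇ n) ≡ true → m ≤ n
≤ᵇ-true⁻ {m} {n} e = ≤ᵇ⇒≤ m n (Equivalence.from T-≡ e)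

≤ᵇ-true⁺ : ∀ {m n} → m ≤ n → (m ≤ᵇ n) ≡ true
≤ᵇ-true⁺ e = Equivalence.to T-≡ (≤⇒≤ᵇ e)

≤ᵇ-false⁻ : ∀ {m n} → (m ≤ᵇ n) ≡ false → n < m
≤ᵇ-false⁻ {m} {n} e with m ≤? n
... | yes m≤n = contradiction (trans (sym (≤ᵇ-true⁺ m≤n)) e) λ ()
... | no  m≰n = ≰⇒> m≰n

≡ᵇ0-false⁻ : ∀ {m} → (m ≡ᵇ 0) ≡ false → 0 < m
≡ᵇ0-false⁻ {suc m} _ = z<s

χ-≤1 : ∀ b → χ b ≤ 1
χ-≤1 true  = ≤-refl
χ-≤1 false = z≤n

χ-mono : ∀ {a b} → (a ≡ true → b ≡ true) → χ a ≤ χ b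
χ-mono {false} _ = z≤n
χ-mono {true}  h rewrite h refl = ≤-refl

χ-≤ : ∀ {b n} → (b ≡ true → 1 ≤ n) → χ b ≤ n
χ-≤ {false} _ = z≤n
χ-≤ {true}  h = h refl

χ≡0⇒false : ∀ {b} → χ b ≡ 0 → b ≡ false
χ≡0⇒false {false} _ = refl

∑ : List A → (A → ℕ) → ℕ
∑ []       f = 0
∑ (x ∷ xs) f = f x + ∑ xs f

∑-cong : (xs : List A) {f g : A → ℕ} → (∀ x → f x ≡ g x) → ∑ xs f ≡ ∑ xs g
∑-cong []       h = refl
∑-cong (x ∷ xs) h = cong₂ _+_ (h x) (∑-cong xs h)

∑-mono∈ : (xs : List A) {f g : A → ℕ} → (∀ x → x ∈ xs → f x ≤ g x) → ∑ xs f ≤ ∑ xs g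
∑-mono∈ []       h = z≤n
∑-mono∈ (x ∷ xs) h = +-mono-≤ (h x (here refl)) (∑-mono∈ xs λ y y∈ → h y (there y∈))

∑-mono : (xs : List A) {f g : A → ℕ} → (∀ x → f x ≤ g x) → ∑ xs f ≤ ∑ xs g
∑-mono xs h = ∑-mono∈ xs λ x _ → h x

∑-+ : (xs : List A) (f g : A → ℕ) → ∑ xs (λ x → f x + g x) ≡ ∑ xs f + ∑ xs g
∑-+ []       f g = refl
∑-+ (x ∷ xs) f g rewrite ∑-+ xs f g = interchange (f x) (g x) (∑ xs f) (∑ xs g)
  where
  interchange : ∀ a b c d → a + b + (c + d) ≡ a + c + (b + d)
  interchange a b c d = solve (a ∷ b ∷ c ∷ d ∷ [])

∑-0 : (xs : List A) → ∑ xs (λ _ → 0) ≡ 0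
∑-0 []       = refl
∑-0 (x ∷ xs) = ∑-0 xs

∑-*ˡ : (xs : List A) (c : ℕ) (f : A → ℕ) → ∑ xs (λ x → c * f x) ≡ c * ∑ xs f
∑-*ˡ []       c f = sym (*-zeroʳ c)
∑-*ˡ (x ∷ xs) c f = trans (cong (c * f x +_) (∑-*ˡ xs c f)) (sym (*-distribˡ-+ c (f x) (∑ xs f)))

∑-*ʳ : (xs : List A) (c : ℕ) (f : A → ℕ) → ∑ xs (λ x → f x * c) ≡ ∑ xs f * c
∑-*ʳ xs c f = trans (∑-cong xs λ x → *-comm (f x) c) (trans (∑-*ˡ xs c f) (*-comm c _))

∑-swap : (xs : List A) (ys : List B) (f : A → B → ℕ) →
         ∑ xs (λ x → ∑ ys (f x)) ≡ ∑ ys (λ y → ∑ xs (λ x → f x y))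
∑-swap []       ys f = sym (∑-0 ys)
∑-swap (x ∷ xs) ys f = trans (cong (∑ ys (f x) +_) (∑-swap xs ys f))
                             (sym (∑-+ ys (f x) (λ y → ∑ xs (λ x → f x y))))

∑-const : (xs : List A) (c : ℕ) → ∑ xs (λ _ → c) ≡ length xs * c
∑-const []       c = refl
∑-const (x ∷ xs) c = cong (c +_) (∑-const xs c)

∑-∈-≤ : {xs : List A} {x : A} (f : A → ℕ) → x ∈ xs → f x ≤ ∑ xs f
∑-∈-≤ f (here refl) = m≤m+n _ _
∑-∈-≤ f (there x∈)  = ≤-trans (∑-∈-≤ f x∈) (m≤n+m _ _)

∑-applyUpTo : (n : ℕ) (g : ℕ → A) (f : A → ℕ) → ∑ (applyUpTo g n) f ≡ ∑ (upTo n) (f ∘ g)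
∑-applyUpTo zero    g f = refl
∑-applyUpTo (suc n) g f = cong (f (g 0) +_)
  (trans (∑-applyUpTo n (g ∘ suc) f) (sym (∑-applyUpTo n suc (f ∘ g))))

∑-upTo-suc : (n : ℕ) (f : ℕ → ℕ) → ∑ (upTo (suc n)) f ≡ f 0 + ∑ (upTo n) (f ∘ suc)
∑-upTo-suc n f = cong (f 0 +_) (∑-applyUpTo n suc f)

∑-upTo-const : (n c : ℕ) → ∑ (upTo n) (λ _ → c) ≡ n * c
∑-upTo-const n c = trans (∑-const (upTo n) c) (cong (_* c) (length-upTo n))

length-allFin : ∀ n → length (allFin n) ≡ n
length-allFin n = length-tabulate id

∑-upTo-≤1 : (n : ℕ) (P : ℕ → Bool) → (∀ {x y} → P x ≡ true → P y ≡ true → x ≡ y) →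
            ∑ (upTo n) (χ ∘ P) ≤ 1
∑-upTo-≤1 zero    P unique = z≤n
∑-upTo-≤1 (suc n) P unique rewrite ∑-upTo-suc n (χ ∘ P) with P 0 in P0
... | false = ∑-upTo-≤1 n (P ∘ suc) λ p q → suc-injective (unique p q)
... | true  = s≤s (≤-reflexive (trans (∑-cong (upTo n) vanish) (∑-0 (upTo n))))
  where
  vanish : ∀ x → χ (P (suc x)) ≡ 0
  vanish x with P (suc x) in Psx
  ... | false = refl
  ... | true  = contradiction (unique P0 Psx) λ ()

∑χ≡0⇒false : {xs : List A} {x : A} (P : A → Bool) → ∑ xs (χ ∘ P) ≡ 0 → x ∈ xs → P x ≡ false
∑χ≡0⇒false P e x∈ = χ≡0⇒false (n≤0⇒n≡0 (≤-trans (∑-∈-≤ (χ ∘ P) x∈) (≤-reflexive e)))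

-- Failure is reported as `n` itself. With bound `suc Δ` this failure value is a code for an
-- uncoloured vertex.
search : ℕ → (ℕ → Bool) → ℕ
search zero    P = 0
search (suc n) P = if P 0 then 0 else suc (search n (P ∘ suc))

search-≤ : ∀ n P → search n P ≤ n
search-≤ zero    P = z≤n
search-≤ (suc n) P with P 0
... | true  = z≤n
... | false = s≤s (search-≤ n (P ∘ suc))

data Searched (n : ℕ) (P : ℕ → Bool) (m : ℕ) : Set where
  found  : m < n → P m ≡ true → (∀ {k} → k < m → P k ≡ false) → Searched n P m
  absent : m ≡ n → (∀ {k} → k < n → P k ≡ false) → Searched n P m

searched : ∀ n P → Searched n P (search n P)
searched zero    P = absent refl λ ()
searched (suc n) P with P 0 in P0
... | true  = found z<s P0 λ ()
... | false with searched n (P ∘ suc)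
...   | found m<n Pm before = found (s<s m<n) Pm before′
  where
  before′ : ∀ {k} → k < suc (search n (P ∘ suc)) → P k ≡ false
  before′ {zero}  _         = P0
  before′ {suc k} (s<s k<m) = before k<m
...   | absent m≡n none = absent (cong suc m≡n) none′
  where
  none′ : ∀ {k} → k < suc n → P k ≡ false
  none′ {zero}  _         = P0
  none′ {suc k} (s<s k<n) = none k<n

-- Truncation at `k` hides every test from `k` on. This form lets join times that depend on each
-- other circularly become stable one value per round.
search-cong-below : ∀ n k {P Q} → (∀ {m} → m < k → P m ≡ Q m) → search n P ⊓ k ≡ search n Q ⊓ k
search-cong-below zero    k       h = refl
search-cong-below (suc n) zero    h = trans (⊓-zeroʳ _) (sym (⊓-zeroʳ _))
search-cong-below (suc n) (suc k) {P} {Q} h rewrite h {0} z<s with Q 0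
... | true  = refl
... | false = cong suc (search-cong-below n k (h ∘ s<s))

search-cong : ∀ n {P Q} → (∀ m → P m ≡ Q m) → search n P ≡ search n Q
search-cong zero    h = refl
search-cong (suc n) {P} {Q} h rewrite h 0 with Q 0
... | true  = refl
... | false = cong suc (search-cong n (h ∘ suc))

∑-map : (xs : List A) (g : A → B) (f : B → ℕ) → ∑ (map g xs) f ≡ ∑ xs (f ∘ g)
∑-map []       g f = refl
∑-map (x ∷ xs) g f = cong (f (g x) +_) (∑-map xs g f)

length-cartesianProductWith : {C : Set} (f : A → B → C) (xs : List A) (ys : List B) →
  length (cartesianProductWith f xs ys) ≡ length xs * length ys
length-cartesianProductWith f []       ys = refl
length-cartesianProductWith f (x ∷ xs) ys =
  trans (length-++ (map (f x) ys)) (cong₂ _+_ (length-map (f x) ys) (length-cartesianProductWith f xs ys))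

2^-cancel-≤ : ∀ {m n} → 2 ^ m ≤ 2 ^ n → m ≤ n
2^-cancel-≤ {m} {n} h with m ≤? n
... | yes m≤n = m≤n
... | no  m≰n = contradiction h (<⇒≱ (^-monoʳ-< 2 (s<s z<s) (≰⇒> m≰n)))

2^-mono-≤ : ∀ {m n} → m ≤ n → 2 ^ m ≤ 2 ^ n
2^-mono-≤ = ^-monoʳ-≤ 2

0<2^ : ∀ n → 0 < 2 ^ n
0<2^ n = m^n>0 2 n

-- Families of functions with few agreements

-- A partial function to be avoided, given by its graph: `unique` leaves at most one bad value per
-- position, so a random value among `Y` is bad with probability at most 1/`Y`.
record Test : Set where
  field
    holds  : ℕ → ℕ → Bool
    unique : ∀ x {y y′} → holds x y ≡ true → holds x y′ ≡ true → y ≡ y′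
open Test

agreement : ℕ → Test → (ℕ → ℕ) → ℕ
agreement T R g = ∑ (upTo T) (λ x → χ (holds R x (g x)))

shift : Test → Test
shift R = record { holds = λ x → holds R (suc x) ; unique = λ x → unique R (suc x) }

weight : List (Test × ℕ) → ℕ
weight ws = ∑ ws proj₂

hit : ℕ → List (Test × ℕ) → ℕ
hit y ws = ∑ ws λ (R , w) → χ (holds R 0 y) * w

-- The weight doubles at each hit, so a test that starts with weight 1 carries 2 to the number of
-- agreements so far; `shift` drops the position already decided.
advance : ℕ → List (Test × ℕ) → List (Test × ℕ)
advance y = map λ (R , w) → shift R , w + χ (holds R 0 y) * w

cheapest : ℕ → List (Test × ℕ) → ℕ
cheapest Y ws = search Y λ y → Y * hit y ws ≤ᵇ weight ws

greedy : ℕ → ℕ → List (Test × ℕ) → ℕ → ℕ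
greedy Y zero    ws x       = 0
greedy Y (suc T) ws zero    = cheapest Y ws
greedy Y (suc T) ws (suc x) = greedy Y T (advance (cheapest Y ws) ws) x

∑-hit : ∀ Y ws → ∑ (upTo Y) (λ y → hit y ws) ≤ weight ws
∑-hit Y ws = begin
  ∑ (upTo Y) (λ y → hit y ws)                                  ≡⟨ ∑-swap (upTo Y) ws _ ⟩
  ∑ ws (λ (R , w) → ∑ (upTo Y) (λ y → χ (holds R 0 y) * w))    ≡⟨ ∑-cong ws (λ (R , w) → ∑-*ʳ (upTo Y) w _) ⟩
  ∑ ws (λ (R , w) → ∑ (upTo Y) (λ y → χ (holds R 0 y)) * w)
    ≤⟨ ∑-mono ws (λ (R , w) → ≤-trans (*-monoˡ-≤ w (∑-upTo-≤1 Y (holds R 0) (unique R 0))) (≤-reflexive (*-identityˡ w))) ⟩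
  weight ws                                                    ∎
  where open ≤-Reasoning

-- Averaging: by `∑-hit` the mean of `hit` over the `Y` values is at most the weight divided by `Y`,
-- so the search cannot fail.
cheapest-spec : ∀ Y ws → 0 < Y → cheapest Y ws < Y × Y * hit (cheapest Y ws) ws ≤ weight ws
cheapest-spec Y ws 0<Y with searched Y (λ y → Y * hit y ws ≤ᵇ weight ws)
... | found y<Y cheap _ = y<Y , ≤ᵇ-true⁻ cheap
... | absent _ dear = contradiction total (<⇒≱ (*-monoʳ-< Y {{>-nonZero 0<Y}} (n<1+n (weight ws))))
  where
  open ≤-Reasoning
  total : Y * suc (weight ws) ≤ Y * weight ws
  total = begin
    Y * suc (weight ws)                        ≡⟨ ∑-upTo-const Y _ ⟨
    ∑ (upTo Y) (λ _ → suc (weight ws))         ≤⟨ ∑-mono∈ (upTo Y) (λ y y∈ → ≤ᵇ-false⁻ (dear (∈-upTo⁻ y∈))) ⟩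
    ∑ (upTo Y) (λ y → Y * hit y ws)            ≡⟨ ∑-*ˡ (upTo Y) Y _ ⟩
    Y * ∑ (upTo Y) (λ y → hit y ws)            ≤⟨ *-monoʳ-≤ Y (∑-hit Y ws) ⟩
    Y * weight ws                              ∎

greedy-< : ∀ Y T ws x → 0 < Y → greedy Y T ws x < Y
greedy-< Y zero    ws x       0<Y = 0<Y
greedy-< Y (suc T) ws zero    0<Y = proj₁ (cheapest-spec Y ws 0<Y)
greedy-< Y (suc T) ws (suc x) 0<Y = greedy-< Y T _ x 0<Y

potential : ℕ → ℕ → List (Test × ℕ) → ℕ
potential Y T ws = ∑ ws λ (R , w) → 2 ^ agreement T R (greedy Y T ws) * w

potential-suc : ∀ Y T ws → potential Y (suc T) ws ≡ potential Y T (advance (cheapest Y ws) ws)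
potential-suc Y T ws = trans (∑-cong ws unfold) (sym (∑-map ws _ _))
  where
  y = cheapest Y ws
  double : ∀ b a w → 2 ^ (χ b + a) * w ≡ 2 ^ a * (w + χ b * w)
  double true  a w = lemma (2 ^ a) w
    where
    lemma : ∀ p w → 2 * p * w ≡ p * (w + (w + 0))
    lemma p w = solve (p ∷ w ∷ [])
  double false a w = cong (2 ^ a *_) (sym (+-identityʳ w))
  unfold : ∀ p → 2 ^ agreement (suc T) (proj₁ p) (greedy Y (suc T) ws) * proj₂ p ≡
                 2 ^ agreement T (shift (proj₁ p)) (greedy Y T (advance y ws)) * (proj₂ p + χ (holds (proj₁ p) 0 y) * proj₂ p)
  unfold (R , w) rewrite ∑-upTo-suc T (λ x → χ (holds R x (greedy Y (suc T) ws x))) = double (holds R 0 y) _ w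

-- The average choice of a value multiplies the total weight by at most 1 + 1/Y, and 1 + 1/Y ≤ (m + 1)/m for m < Y.
potential-≤ : ∀ Y T m ws → 0 < Y → m + T ≤ Y → m * potential Y T ws ≤ (m + T) * weight ws
potential-≤ Y zero m ws 0<Y _ =
  ≤-reflexive (cong₂ _*_ (sym (+-identityʳ m)) (∑-cong ws λ (R , w) → *-identityˡ w))
potential-≤ Y (suc T) m ws 0<Y m+T<Y = begin
  m * potential Y (suc T) ws              ≡⟨ cong (m *_) (potential-suc Y T ws) ⟩
  m * potential Y T ws′                   ≤⟨ potential-≤ Y T m ws′ 0<Y m+T≤Y ⟩
  (m + T) * weight ws′                    ≡⟨ cong ((m + T) *_) weight′ ⟩
  (m + T) * (weight ws + hit y ws)        ≡⟨ *-distribˡ-+ (m + T) (weight ws) _ ⟩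
  (m + T) * weight ws + (m + T) * hit y ws ≤⟨ +-monoʳ-≤ _ (≤-trans (*-monoˡ-≤ (hit y ws) m+T≤Y) (proj₂ (cheapest-spec Y ws 0<Y))) ⟩
  (m + T) * weight ws + weight ws         ≡⟨ +-comm _ (weight ws) ⟩
  suc (m + T) * weight ws                 ≡⟨ cong (_* weight ws) (sym (+-suc m T)) ⟩
  (m + suc T) * weight ws                 ∎
  where
  open ≤-Reasoning
  y = cheapest Y ws
  ws′ = advance y ws
  m+T≤Y : m + T ≤ Y
  m+T≤Y = ≤-trans (+-monoʳ-≤ m (n≤1+n T)) m+T<Y
  weight′ : weight ws′ ≡ weight ws + hit y ws
  weight′ = trans (∑-map ws _ _) (∑-+ ws proj₂ _)

avoid : ℕ → List Test → ℕ → ℕ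
avoid T Rs = greedy (2 * T) T (map (_, 1) Rs)

-- The range is twice the length, so `potential-≤` with `m = T` loses only a factor 2. One summand
-- is at most the whole potential; hence the agreement is logarithmic in the number of tests.
avoid-agreement : ∀ T Rs {R} → 0 < T → R ∈ Rs → 2 ^ agreement T R (avoid T Rs) ≤ 2 * length Rs
avoid-agreement T Rs {R} 0<T R∈ = begin
  2 ^ agreement T R (avoid T Rs)       ≡⟨ *-identityʳ _ ⟨
  2 ^ agreement T R (avoid T Rs) * 1   ≤⟨ ∑-∈-≤ (λ (R , w) → 2 ^ agreement T R (avoid T Rs) * w) (∈-map⁺ (_, 1) R∈) ⟩
  potential (2 * T) T ws               ≤⟨ *-cancelˡ-≤ T {{>-nonZero 0<T}} bound ⟩
  2 * length Rs                        ∎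
  where
  open ≤-Reasoning
  ws = map (_, 1) Rs
  weight-ws : weight ws ≡ length Rs
  weight-ws = trans (∑-map Rs (_, 1) proj₂) (trans (∑-const Rs 1) (*-identityʳ _))
  bound : T * potential (2 * T) T ws ≤ T * (2 * length Rs)
  bound = begin
    T * potential (2 * T) T ws ≤⟨ potential-≤ (2 * T) T T ws (<-≤-trans 0<T (m≤m+n T _)) (+-monoʳ-≤ T (m≤m+n T 0)) ⟩
    (T + T) * weight ws        ≡⟨ cong ((T + T) *_) weight-ws ⟩
    (T + T) * length Rs        ≡⟨ lemma T (length Rs) ⟩
    T * (2 * length Rs)        ∎
    where
    lemma : ∀ t k → (t + t) * k ≡ t * (2 * k)
    lemma t k = solve (t ∷ k ∷ [])

-- Agreement up to the shift `i - j`, written without subtraction. Shifts are needed because the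
-- slices of the palette are translates of the graphs of words.
offsetTest : (ℕ → ℕ) → ℕ × ℕ → Test
offsetTest g (i , j) = record
  { holds  = λ x y → (y + j) ≡ᵇ (g x + i)
  ; unique = λ x {y} {y′} p q → +-cancelʳ-≡ j y y′ (trans (≡ᵇ-true⁻ {y + j} p) (sym (≡ᵇ-true⁻ {y′ + j} q)))
  }

offsets : ℕ → List (ℕ × ℕ)
offsets J = cartesianProductWith _,_ (upTo J) (upTo J)

-- The word of colour s is chosen against all earlier words and, so that it takes no value often, the zero word.
words : ℕ → ℕ → List (ℕ → ℕ)
tests : ℕ → ℕ → List Test

words τ zero    = (λ _ → 0) ∷ []
words τ (suc s) = avoid (2 ^ τ) (tests τ s) ∷ words τ s

tests τ s = cartesianProductWith offsetTest (words τ s) (offsets (2 ^ (3 + τ)))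

opaque
  word : ℕ → ℕ → ℕ → ℕ
  word τ s = avoid (2 ^ τ) (tests τ s)

  word-< : ∀ τ s x → word τ s x < 2 ^ suc τ
  word-< τ s x = greedy-< (2 ^ suc τ) (2 ^ τ) _ x (0<2^ (suc τ))

opaque
  unfolding word

  earlier∈words : ∀ τ {s s′} → s′ < s → word τ s′ ∈ words τ s
  earlier∈words τ {suc s} (s<s s′≤s) with m≤n⇒m<n∨m≡n s′≤s
  ... | inj₁ s′<s = there (earlier∈words τ s′<s)
  ... | inj₂ refl = here refl

zero∈words : ∀ τ s → (λ _ → 0) ∈ words τ s
zero∈words τ zero    = here refl
zero∈words τ (suc s) = there (zero∈words τ s)

length-words : ∀ τ s → length (words τ s) ≡ suc s
length-words τ zero    = refl
length-words τ (suc s) = cong suc (length-words τ s)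

length-tests : ∀ τ s → length (tests τ s) ≡ suc s * 2 ^ ((3 + τ) + (3 + τ))
length-tests τ s = trans (length-cartesianProductWith offsetTest (words τ s) (offsets J))
  (cong₂ _*_ (length-words τ s) (trans (length-cartesianProductWith _,_ (upTo J) (upTo J))
    (trans (cong₂ _*_ (length-upTo J) (length-upTo J)) (sym (^-distribˡ-+-* 2 (3 + τ) (3 + τ))))))
  where J = 2 ^ (3 + τ)

-- The binary logarithm of twice the number of tests when `suc s` is `2 ^ b`. The `3 + τ` bits per
-- shift make room for slice numbers, which reach `2 * Y`, four times `2 ^ ρ`.
capacity : ℕ → ℕ → ℕ
capacity b τ = suc (b + ((3 + τ) + (3 + τ)))

opaque
  unfolding word

  word-agreement : ∀ {τ b s g i j} → s < 2 ^ b → g ∈ words τ s → i < 2 ^ (3 + τ) → j < 2 ^ (3 + τ) →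
                   ∑ (upTo (2 ^ τ)) (λ x → χ ((word τ s x + j) ≡ᵇ (g x + i))) ≤ capacity b τ
  word-agreement {τ} {b} {s} {g} {i} {j} s<2^b g∈ i<J j<J = 2^-cancel-≤ (begin
    2 ^ agreement (2 ^ τ) R (word τ s)             ≤⟨ avoid-agreement (2 ^ τ) (tests τ s) (0<2^ τ) R∈ ⟩
    2 * length (tests τ s)                         ≡⟨ cong (2 *_) (length-tests τ s) ⟩
    2 * (suc s * 2 ^ ((3 + τ) + (3 + τ)))          ≤⟨ *-monoʳ-≤ 2 (*-monoˡ-≤ _ s<2^b) ⟩
    2 * (2 ^ b * 2 ^ ((3 + τ) + (3 + τ)))          ≡⟨ cong (2 *_) (sym (^-distribˡ-+-* 2 b _)) ⟩
    2 ^ capacity b τ                               ∎)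
    where
    open ≤-Reasoning
    R : Test
    R = offsetTest g (i , j)
    R∈ : R ∈ tests τ s
    R∈ = ∈-cartesianProductWith⁺ offsetTest g∈ (∈-cartesianProductWith⁺ _,_ (∈-upTo⁺ i<J) (∈-upTo⁺ j<J))

-- The later of two words was chosen against the earlier one; the two cases exchange the roles of
-- `i` and `j`.
word-meets : ∀ {τ b s s′ i j} → s < 2 ^ b → s′ < 2 ^ b → s ≢ s′ → i < 2 ^ (3 + τ) → j < 2 ^ (3 + τ) →
             ∑ (upTo (2 ^ τ)) (λ x → χ ((word τ s x + j) ≡ᵇ (word τ s′ x + i))) ≤ capacity b τ
word-meets {τ} {b} {s} {s′} {i} {j} s< s′< s≢s′ i<J j<J with <-cmp s s′
... | tri≈ _ s≡s′ _ = contradiction s≡s′ s≢s′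
... | tri> _ _ s′<s = word-agreement s< (earlier∈words τ s′<s) i<J j<J
... | tri< s<s′ _ _ = ≤-trans
  (∑-mono (upTo (2 ^ τ)) λ x → χ-mono λ e → ≡ᵇ-true⁺ (sym (≡ᵇ-true⁻ {word τ s x + j} e)))
  (word-agreement s′< (earlier∈words τ s<s′) j<J i<J)

-- The zero word shifted by `y` is the constant `y`.
word-takes : ∀ {τ b s y} → s < 2 ^ b → y < 2 ^ (3 + τ) →
             ∑ (upTo (2 ^ τ)) (λ x → χ (word τ s x ≡ᵇ y)) ≤ capacity b τ
word-takes {τ} {b} {s} {y} s< y<J = ≤-trans
  (∑-mono (upTo (2 ^ τ)) λ x → χ-mono λ e → ≡ᵇ-true⁺ (trans (+-identityʳ _) (≡ᵇ-true⁻ {word τ s x} e)))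
  (word-agreement s< (zero∈words τ s) y<J (0<2^ (3 + τ)))

-- Linial's colour reduction

pairing-< : ∀ {Y x x′ y} y′ → y < Y → x < x′ → x * Y + y < x′ * Y + y′
pairing-< {Y} {x} {x′} {y} y′ y<Y x<x′ = begin-strict
  x * Y + y       <⟨ +-monoʳ-< (x * Y) y<Y ⟩
  x * Y + Y       ≡⟨ +-comm (x * Y) Y ⟩
  suc x * Y       ≤⟨ *-monoˡ-≤ Y x<x′ ⟩
  x′ * Y          ≤⟨ m≤m+n _ y′ ⟩
  x′ * Y + y′     ∎
  where open ≤-Reasoning

pairing-injective : ∀ {Y x x′ y y′} → y < Y → y′ < Y → x * Y + y ≡ x′ * Y + y′ → x ≡ x′ × y ≡ y′
pairing-injective {Y} {x} {x′} {y} {y′} y<Y y′<Y e with <-cmp x x′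
... | tri< x<x′ _ _ = contradiction e (<⇒≢ (pairing-< y′ y<Y x<x′))
... | tri> _ _ x′<x = contradiction (sym e) (<⇒≢ (pairing-< y y′<Y x′<x))
... | tri≈ _ refl _ = refl , +-cancelˡ-≡ (x * Y) y y′ e

clashes : ∀ {d} → ℕ → ℕ → (Fin d → ℕ) → ℕ → ℕ
clashes {d} τ s S x = ∑ (allFin d) λ i → χ (word τ s x ≡ᵇ word τ (S i) x)

-- Linial's step: the new colour codes the first position where the word of `s` differs from the
-- words of all neighbours, together with the value there.
linStep : ∀ {d} → ℕ → ℕ → (Fin d → ℕ) → ℕ
linStep τ s S = x * 2 ^ suc τ + word τ s x
  where x = search (2 ^ τ) λ x → clashes τ s S x ≡ᵇ 0

linStep-cong : ∀ {d} τ {s s′} {S S′ : Fin d → ℕ} → s ≡ s′ → (∀ i → S i ≡ S′ i) → linStep τ s S ≡ linStep τ s′ S′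
linStep-cong {d} τ {s} {S = S} {S′} refl h = cong (λ x → x * 2 ^ suc τ + word τ s x)
  (search-cong (2 ^ τ) λ x → cong (_≡ᵇ 0) (∑-cong (allFin d) λ i → cong (λ s′ → χ (word τ s x ≡ᵇ word τ s′ x)) (h i)))

linStep-< : ∀ {d} τ s (S : Fin d → ℕ) → linStep τ s S < 2 ^ (2 + (τ + τ))
linStep-< τ s S = begin-strict
  linStep τ s S              <⟨ +-monoʳ-< (x * Y) (word-< τ s x) ⟩
  x * Y + Y                  ≤⟨ +-mono-≤ (*-monoˡ-≤ Y (search-≤ (2 ^ τ) _)) (m≤n*m Y (2 ^ τ) {{>-nonZero (0<2^ τ)}}) ⟩
  2 ^ τ * Y + 2 ^ τ * Y      ≡⟨ lemma (2 ^ τ) ⟩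
  2 * (2 * (2 ^ τ * 2 ^ τ))  ≡⟨ cong (λ z → 2 * (2 * z)) (sym (^-distribˡ-+-* 2 τ τ)) ⟩
  2 ^ (2 + (τ + τ))          ∎
  where
  open ≤-Reasoning
  x = search (2 ^ τ) λ x → clashes τ s S x ≡ᵇ 0
  Y = 2 ^ suc τ
  lemma : ∀ t → t * (2 * t) + t * (2 * t) ≡ 2 * (2 * (t * t))
  lemma t = solve (t ∷ [])

linStep-finds : ∀ {d} τ b s (S : Fin d → ℕ) → s < 2 ^ b → (∀ i → S i < 2 ^ b) → (∀ i → s ≢ S i) →
                d * capacity b τ < 2 ^ τ →
                ∃ λ x → linStep τ s S ≡ x * 2 ^ suc τ + word τ s x × (∀ i → word τ s x ≢ word τ (S i) x)
linStep-finds {d} τ b s S s< S< s≢S few with searched (2 ^ τ) (λ x → clashes τ s S x ≡ᵇ 0)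
... | found _ none _ = _ , refl , λ i e → contradiction
        (trans (sym (≡ᵇ-true⁺ e)) (∑χ≡0⇒false _ (≡ᵇ-true⁻ none) (∈-allFin i))) λ ()
... | absent _ some = contradiction total (<⇒≱ few)
  where
  open ≤-Reasoning
  total : 2 ^ τ ≤ d * capacity b τ
  total = begin
    2 ^ τ                                     ≡⟨ *-identityʳ _ ⟨
    2 ^ τ * 1                                 ≡⟨ ∑-upTo-const (2 ^ τ) 1 ⟨
    ∑ (upTo (2 ^ τ)) (λ _ → 1)                ≤⟨ ∑-mono∈ (upTo (2 ^ τ)) (λ x x∈ → ≡ᵇ0-false⁻ (some (∈-upTo⁻ x∈))) ⟩
    ∑ (upTo (2 ^ τ)) (clashes τ s S)          ≡⟨ ∑-swap (upTo (2 ^ τ)) (allFin d) _ ⟩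
    ∑ (allFin d) (λ i → ∑ (upTo (2 ^ τ)) λ x → χ (word τ s x ≡ᵇ word τ (S i) x))
      ≤⟨ ∑-mono (allFin d) (λ i → ≤-trans
           (∑-mono (upTo (2 ^ τ)) λ x → χ-mono λ e → ≡ᵇ-true⁺ (cong (_+ 0) (≡ᵇ-true⁻ {word τ s x} e)))
           (word-meets s< (S< i) (s≢S i) (0<2^ (3 + τ)) (0<2^ (3 + τ)))) ⟩
    ∑ (allFin d) (λ _ → capacity b τ)         ≡⟨ ∑-const (allFin d) _ ⟩
    length (allFin d) * capacity b τ          ≡⟨ cong (_* capacity b τ) (length-allFin d) ⟩
    d * capacity b τ                          ∎

module _ {n : ℕ} (G : PortGraph n) where

  Signal : Set
  Signal = ℕ → Fin n → ℕ

  Stable : ℕ → Signal → Set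
  Stable t₀ s = ∀ t v → t₀ ≤ t → s (suc t) v ≡ s t v

  record Proper (b : ℕ) (s : Fin n → ℕ) : Set where
    field
      bounded  : ∀ v → s v < 2 ^ b
      distinct : ∀ v i → s v ≢ s (nbr G v i)
  open Proper public

  Stable-≤ : ∀ {t₀ t₁ s} → t₀ ≤ t₁ → Stable t₀ s → Stable t₁ s
  Stable-≤ t₀≤t₁ st t v t₁≤t = st t v (≤-trans t₀≤t₁ t₁≤t)

  linStep-stable : ∀ τ {t₀ s s′} → (∀ t v → s′ (suc t) v ≡ linStep τ (s (suc t) v) (λ i → s t (nbr G v i))) →
                   Stable t₀ s → Stable (suc t₀) s′
  linStep-stable τ rule st (suc t) v (s≤s t₀≤t) = trans (rule (suc t) v) (trans
    (linStep-cong τ (st (suc t) v (m≤n⇒m≤1+n t₀≤t)) λ i → st t (nbr G v i) t₀≤t) (sym (rule t v)))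

  -- Neighbours with equal new colours would have chosen the same position and their words would
  -- agree there, which the choice of position excludes.
  linStep-proper : ∀ τ b {s s′ : Fin n → ℕ} → Proper b s → (∀ v → deg G v * capacity b τ < 2 ^ τ) →
                   (∀ v → s′ v ≡ linStep τ (s v) (λ i → s (nbr G v i))) → Proper (2 + (τ + τ)) s′
  linStep-proper τ b {s} {s′} P few rule = record
    { bounded  = λ v → subst (_< 2 ^ (2 + (τ + τ))) (sym (rule v)) (linStep-< τ (s v) λ i → s (nbr G v i))
    ; distinct = distinct′
    }
    where
    finds : ∀ v → ∃ λ x → linStep τ (s v) (λ i → s (nbr G v i)) ≡ x * 2 ^ suc τ + word τ (s v) x ×
                          (∀ i → word τ (s v) x ≢ word τ (s (nbr G v i)) x)
    finds v = linStep-finds τ b (s v) (λ i → s (nbr G v i)) (bounded P v) (λ i → bounded P _) (distinct P v) (few v)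
    distinct′ : ∀ v i → s′ v ≢ s′ (nbr G v i)
    distinct′ v i e with finds v | finds (nbr G v i)
    ... | x , eq , free | x′ , eq′ , _ with pairing-injective {2 ^ suc τ} {x} {x′} (word-< τ (s v) x) (word-< τ (s (nbr G v i)) x′)
                                           (trans (sym (trans (rule v) eq)) (trans e (trans (rule _) eq′)))
    ...   | refl , y≡y′ = free i y≡y′

next : (ℕ → ℕ) → ℕ → ℕ
next stage b = 2 + (stage b + stage b)

iterate : ℕ → (A → A) → A → A
iterate zero    f a = a
iterate (suc k) f a = iterate k f (f a)

LinState : ℕ → Set
LinState zero    = ⊤
LinState (suc L) = ℕ × LinState L

linOut : ∀ L → ℕ → LinState L → ℕ
linOut zero    s _        = s
linOut (suc L) s (s′ , r) = linOut L s′ r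

linRule : ∀ {d} → (ℕ → ℕ) → ∀ L → ℕ → ℕ → (Fin d → ℕ) → (Fin d → LinState L) → LinState L
linRule stage zero    b s S R = tt
linRule stage (suc L) b s S R = s′ , linRule stage L (next stage b) s′ (proj₁ ∘ R) (proj₂ ∘ R)
  where s′ = linStep (stage b) s S

module _ {n : ℕ} (G : PortGraph n) (stage : ℕ → ℕ) (few : ∀ b v → deg G v * capacity b (stage b) < 2 ^ stage b) where

  -- Each level settles one round after the level it is computed from. From then on the neighbours'
  -- last values are also their present ones, so properness passes on as for a static colouring.
  lin-stable : ∀ L b t₀ (s : Signal G) (r : ℕ → Fin n → LinState L) →
    (∀ t v → r (suc t) v ≡ linRule stage L b (s (suc t) v) (λ i → s t (nbr G v i)) (λ i → r t (nbr G v i))) →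
    Stable G t₀ s → (∀ t → t₀ ≤ t → Proper G b (s t)) →
    Stable G (t₀ + L) (λ t v → linOut L (s t v) (r t v)) ×
    (∀ t → t₀ + L ≤ t → Proper G (iterate L (next stage) b) (λ v → linOut L (s t v) (r t v)))
  lin-stable zero    b t₀ s r rule st P = subst (λ t₁ → Stable G t₁ s) (sym (+-identityʳ t₀)) st ,
    λ t t₀≤t → P t (subst (_≤ t) (+-identityʳ t₀) t₀≤t)
  lin-stable (suc L) b t₀ s r rule st P rewrite +-suc t₀ L =
    lin-stable L (next stage b) (suc t₀) s′ (λ t v → proj₂ (r t v)) rule″ (linStep-stable G (stage b) rule′ st) P′
    where
    s′ : Signal G
    s′ t v = proj₁ (r t v)
    rule′ : ∀ t v → s′ (suc t) v ≡ linStep (stage b) (s (suc t) v) (λ i → s t (nbr G v i))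
    rule′ t v = cong proj₁ (rule t v)
    rule″ : ∀ t v → proj₂ (r (suc t) v) ≡
      linRule stage L (next stage b) (s′ (suc t) v) (λ i → s′ t (nbr G v i)) (λ i → proj₂ (r t (nbr G v i)))
    rule″ t v rewrite rule t v = refl
    P′ : ∀ t → suc t₀ ≤ t → Proper G (next stage b) (s′ t)
    P′ (suc t) (s≤s t₀≤t) = linStep-proper G (stage b) b (P (suc t) (m≤n⇒m≤1+n t₀≤t)) (few b)
      λ v → trans (rule′ t v) (linStep-cong (stage b) {s (suc t) v} refl λ i → sym (st t (nbr G v i) t₀≤t))

-- The passes

-- The data of a vertex within one pass: `seed` is its colour from Linial's reduction, `time` the
-- stage at which it adopted a class, `offset` the number of its slice; `previous` and `current` are
-- its colours before and after the pass.
record Report : Set where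
  constructor report
  field
    seed previous time offset current : ℕ
open Report public

module Pass (Δ τ ρ d α : ℕ) where

  Y : ℕ
  Y = 2 ^ suc ρ

  instance
    Y≢0 : NonZero Y
    Y≢0 = m^n≢0 2 (suc ρ)

  -- Only the colours 0, …, Δ are genuine; every larger number means that the vertex is still uncoloured.
  uncoloured : ℕ → Bool
  uncoloured c = Δ <ᵇ c

  class : Report → ℕ
  class u = word τ (seed u) (time u)

  -- At stage x the neighbour occupies the class it has adopted if time u < x, and the class it tries otherwise.
  conflict : ℕ → ℕ → Report → Bool
  conflict s x u = uncoloured (previous u) ∧ (word τ (seed u) (time u ⊓ x) ≡ᵇ word τ s x)

  -- The palette is laid out in rows of length Y; slice j has the column word ρ s (row) + Y − j in each row.  For each s
  -- the slices with j < 2Y partition the palette.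
  member : ℕ → ℕ → ℕ → Bool
  member s j z = (z % Y + j) ≡ᵇ (word ρ s (z / Y) + Y)

  blocks : ℕ → ℕ → Report → Bool
  blocks κ z u = (previous u ≡ᵇ z) ∨ ((class u <ᵇ κ) ∧ (current u ≡ᵇ z))

  -- Ties in `time` count as ahead in both directions, so two such neighbours avoid each other's
  -- slices.
  ahead : ℕ → ℕ → Report → Bool
  ahead κ x u = uncoloured (previous u) ∧ ((class u ≡ᵇ κ) ∧ (time u ≤ᵇ x))

  rival : ℕ → ℕ → ℕ → Report → Bool
  rival κ x z u = ahead κ x u ∧ member (seed u) (offset u) z

  count : ∀ {δ} → (Report → Bool) → (Fin δ → Report) → ℕ
  count {δ} P us = ∑ (allFin δ) λ i → χ (P (us i))

  free : ∀ {δ} → ℕ → (Fin δ → Report) → ℕ → Bool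
  free κ us z = count (blocks κ z) us ≡ᵇ 0

  timeRule : ∀ {δ} → ℕ → (Fin δ → Report) → ℕ
  timeRule s us = search (2 ^ τ) λ x → count (conflict s x) us ≤ᵇ d

  offsetRule : ∀ {δ} → ℕ → ℕ → (Fin δ → Report) → ℕ
  offsetRule κ s us = search (2 * Y) λ j → d * α <ᵇ ∑ (upTo (suc Δ)) (λ z → χ (free κ us z ∧ member s j z))

  admissible : ∀ {δ} → ℕ → ℕ → ℕ → ℕ → (Fin δ → Report) → ℕ → Bool
  admissible κ s x j us z = free κ us z ∧ (member s j z ∧ (count (rival κ x z) us ≡ᵇ 0))

  currentRule : ∀ {δ} → ℕ → ℕ → ℕ → ℕ → ℕ → (Fin δ → Report) → ℕ
  currentRule κ s p x j us = if uncoloured p then search (suc Δ) (admissible κ s x j us) else p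

  count-cong : ∀ {δ} (P Q : Report → Bool) (us us′ : Fin δ → Report) →
               (∀ i → P (us i) ≡ Q (us′ i)) → count P us ≡ count Q us′
  count-cong {δ} P Q us us′ h = ∑-cong (allFin δ) λ i → cong χ (h i)

  -- The test at stage `m` sees a neighbour's time only through its minimum with `m`. Times known up
  -- to `k` fix the tests at stages up to `k`, hence the own time up to `suc k`.
  timeRule-cong : ∀ {δ} k {s s′} (us us′ : Fin δ → Report) → s ≡ s′ →
    (∀ i → seed (us i) ≡ seed (us′ i)) → (∀ i → previous (us i) ≡ previous (us′ i)) →
    (∀ i → time (us i) ⊓ k ≡ time (us′ i) ⊓ k) → timeRule s us ⊓ suc k ≡ timeRule s′ us′ ⊓ suc k
  timeRule-cong k {s} us us′ refl seed≡ previous≡ time≡ = search-cong-below (2 ^ τ) (suc k)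
    λ { {m} (s≤s m≤k) → cong (_≤ᵇ d) (count-cong (conflict s m) (conflict s m) us us′ λ i → cong₂ _∧_ (cong uncoloured (previous≡ i))
      (cong₂ (λ s′ x → word τ s′ x ≡ᵇ word τ s m) (seed≡ i) (below m≤k (time≡ i)))) }
    where
    below : ∀ {a b m} → m ≤ k → a ⊓ k ≡ b ⊓ k → a ⊓ m ≡ b ⊓ m
    below {a} {b} {m} m≤k e = begin
      a ⊓ m       ≡⟨ cong (a ⊓_) (sym (m≥n⇒m⊓n≡n m≤k)) ⟩
      a ⊓ (k ⊓ m) ≡⟨ ⊓-assoc a k m ⟨
      a ⊓ k ⊓ m   ≡⟨ cong (_⊓ m) e ⟩
      b ⊓ k ⊓ m   ≡⟨ ⊓-assoc b k m ⟩
      b ⊓ (k ⊓ m) ≡⟨ cong (b ⊓_) (m≥n⇒m⊓n≡n m≤k) ⟩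
      b ⊓ m       ∎
      where open ≡-Reasoning

  -- The guarded hypotheses here and below record the order of dependence: free colours depend on
  -- colours in lower classes only, rivals on slices in the same class only.
  blocks-cong : ∀ {κ z} u u′ → previous u ≡ previous u′ → class u ≡ class u′ →
                (class u < κ → current u ≡ current u′) → blocks κ z u ≡ blocks κ z u′
  blocks-cong {κ} {z} u u′ previous≡ class≡ current≡ rewrite previous≡ | sym class≡ with class u <ᵇ κ in e
  ... | false = refl
  ... | true  = cong (λ c → (previous u′ ≡ᵇ z) ∨ (c ≡ᵇ z)) (current≡ (<ᵇ-true⁻ {class u} e))

  rival-cong : ∀ {κ x z} u u′ → seed u ≡ seed u′ → previous u ≡ previous u′ → time u ≡ time u′ →
               (class u ≡ κ → offset u ≡ offset u′) → rival κ x z u ≡ rival κ x z u′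
  rival-cong {κ} {x} {z} u u′ refl refl refl offset≡ with class u ≡ᵇ κ in e
  ... | true  = cong (λ j → (uncoloured (previous u) ∧ (time u ≤ᵇ x)) ∧ member (seed u) j z) (offset≡ (≡ᵇ-true⁻ {class u} e))
  ... | false with uncoloured (previous u)
  ...   | true  = refl
  ...   | false = refl

  free-cong : ∀ {δ κ} (us us′ : Fin δ → Report) → (∀ i → previous (us i) ≡ previous (us′ i)) →
    (∀ i → class (us i) ≡ class (us′ i)) → (∀ i → class (us i) < κ → current (us i) ≡ current (us′ i)) →
    ∀ z → free κ us z ≡ free κ us′ z
  free-cong {κ = κ} us us′ previous≡ class≡ current≡ z = cong (_≡ᵇ 0)
    (count-cong (blocks κ z) (blocks κ z) us us′ λ i → blocks-cong (us i) (us′ i) (previous≡ i) (class≡ i) (current≡ i))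

  offsetRule-cong : ∀ {δ κ κ′ s s′} (us us′ : Fin δ → Report) → κ ≡ κ′ → s ≡ s′ →
    (∀ i → previous (us i) ≡ previous (us′ i)) → (∀ i → class (us i) ≡ class (us′ i)) →
    (∀ i → class (us i) < κ → current (us i) ≡ current (us′ i)) → offsetRule κ s us ≡ offsetRule κ′ s′ us′
  offsetRule-cong {s = s} us us′ refl refl previous≡ class≡ current≡ = search-cong (2 * Y) λ j → cong (d * α <ᵇ_)
    (∑-cong (upTo (suc Δ)) λ z → cong (λ b → χ (b ∧ member s j z)) (free-cong us us′ previous≡ class≡ current≡ z))

  currentRule-cong : ∀ {δ κ κ′ s s′ p p′ x x′ j j′} (us us′ : Fin δ → Report) →
    κ ≡ κ′ → s ≡ s′ → p ≡ p′ → x ≡ x′ → j ≡ j′ →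
    (∀ i → seed (us i) ≡ seed (us′ i)) → (∀ i → previous (us i) ≡ previous (us′ i)) → (∀ i → time (us i) ≡ time (us′ i)) →
    (∀ i → class (us i) < κ → current (us i) ≡ current (us′ i)) →
    (∀ i → class (us i) ≡ κ → offset (us i) ≡ offset (us′ i)) →
    currentRule κ s p x j us ≡ currentRule κ′ s′ p′ x′ j′ us′
  currentRule-cong {κ = κ} {s = s} {p = p} {x = x} {j = j} us us′ refl refl refl refl refl seed≡ previous≡ time≡ current≡ offset≡ =
    cong (λ m → if uncoloured p then m else p) (search-cong (suc Δ) λ z → cong₂ _∧_
      (free-cong us us′ previous≡ (λ i → cong₂ (word τ) (seed≡ i) (time≡ i)) current≡ z)
      (cong (λ m → member s j z ∧ (m ≡ᵇ 0)) (count-cong (rival κ x z) (rival κ x z) us us′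
        λ i → rival-cong (us i) (us′ i) (seed≡ i) (previous≡ i) (time≡ i) (offset≡ i))))

  currentRule-≤ : ∀ {δ} κ s p x j (us : Fin δ → Report) → currentRule κ s p x j us ≤ suc Δ
  currentRule-≤ κ s p x j us with Δ <ᵇ p in e
  ... | true  = search-≤ (suc Δ) (admissible κ s x j us)
  ... | false = m≤n⇒m≤1+n (<ᵇ-false⁻ {Δ} e)

  module _ {n : ℕ} (G : PortGraph n) (r : ℕ → Fin n → Report) where

    view : ∀ t v → Fin (deg G v) → Report
    view t v i = r t (nbr G v i)

    -- A vertex uses its own fields as just recomputed, but its neighbours' records of the round
    -- before.
    record Obeys : Set where
      field
        time-rule    : ∀ t v → time (r (suc t) v) ≡ timeRule (seed (r (suc t) v)) (view t v)
        offset-rule  : ∀ t v → offset (r (suc t) v) ≡ offsetRule (class (r (suc t) v)) (seed (r (suc t) v)) (view t v)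
        current-rule : ∀ t v → current (r (suc t) v) ≡ currentRule (class (r (suc t) v)) (seed (r (suc t) v))
                         (previous (r (suc t) v)) (time (r (suc t) v)) (offset (r (suc t) v)) (view t v)

    module Stabilise (obeys : Obeys) {t₀ : ℕ} (seed-stable : Stable G t₀ (λ t v → seed (r t v)))
                     (previous-stable : Stable G t₀ (λ t v → previous (r t v))) where
      open Obeys obeys

      -- Each round extends by one the range in which the times are final, starting from the empty
      -- range at `k = 0`.
      time-stable-below : ∀ k t v → t₀ + k ≤ t → time (r (suc t) v) ⊓ k ≡ time (r t v) ⊓ k
      time-stable-below zero    t v _ = trans (⊓-zeroʳ _) (sym (⊓-zeroʳ _))
      time-stable-below (suc k) t v t≥ rewrite +-suc t₀ k with t | t≥
      ... | suc t′ | s≤s t′≥ rewrite time-rule (suc t′) v | time-rule t′ v =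
        timeRule-cong k (view (suc t′) v) (view t′ v) (seed-stable (suc t′) v (m≤n⇒m≤1+n t₀≤t′)) (λ i → seed-stable t′ _ t₀≤t′)
          (λ i → previous-stable t′ _ t₀≤t′) (λ i → time-stable-below k t′ _ t′≥)
        where
        t₀≤t′ : t₀ ≤ t′
        t₀≤t′ = ≤-trans (m≤m+n t₀ k) t′≥

      -- Time 0 is excluded because the RAM is arbitrary then.
      time-≤ : ∀ t v → 0 < t → time (r t v) ≤ 2 ^ τ
      time-≤ (suc t) v _ rewrite time-rule t v = search-≤ (2 ^ τ) _

      t₁ : ℕ
      t₁ = t₀ + 2 ^ τ

      t₀≤t₁ : t₀ ≤ t₁
      t₀≤t₁ = m≤m+n t₀ (2 ^ τ)

      0<t₁ : 0 < t₁
      0<t₁ = <-≤-trans (0<2^ τ) (m≤n+m (2 ^ τ) t₀)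

      time-stable : Stable G t₁ (λ t v → time (r t v))
      time-stable t v t≥ = begin
        time (r (suc t) v)           ≡⟨ m≤n⇒m⊓n≡m (time-≤ (suc t) v z<s) ⟨
        time (r (suc t) v) ⊓ 2 ^ τ   ≡⟨ time-stable-below (2 ^ τ) t v t≥ ⟩
        time (r t v) ⊓ 2 ^ τ         ≡⟨ m≤n⇒m⊓n≡m (time-≤ t v (<-≤-trans 0<t₁ t≥)) ⟩
        time (r t v)                 ∎
        where open ≡-Reasoning

      class-stable : Stable G t₁ (λ t v → class (r t v))
      class-stable t v t≥ = cong₂ (word τ) (seed-stable t v (≤-trans t₀≤t₁ t≥)) (time-stable t v t≥)

      -- Each class takes two rounds: one to settle the slices, one to settle the colours.
      Settled : ℕ → Set
      Settled k = ∀ t v → t₁ + (k + k) ≤ t → class (r t v) < k → offset (r (suc t) v) ≡ offset (r t v) ×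
                                                              current (r (suc t) v) ≡ current (r t v)

      -- Slices in class `k` depend only on colours in classes below `k`, which `IH` has settled.
      offset-settles : ∀ k → Settled k → ∀ t v → suc (t₁ + (k + k)) ≤ t → class (r t v) < suc k →
                       offset (r (suc t) v) ≡ offset (r t v)
      offset-settles k IH (suc t) v (s≤s t≥) (s≤s class≤k) rewrite offset-rule (suc t) v | offset-rule t v =
        offsetRule-cong (view (suc t) v) (view t v) class≡ (seed-stable (suc t) v (≤-trans t₀≤t₁ (m≤n⇒m≤1+n t₁≤t))) (λ i → previous-stable t _ (≤-trans t₀≤t₁ t₁≤t))
          (λ i → class-stable t _ t₁≤t)
          (λ i class< → proj₂ (IH t _ t≥ (<-≤-trans (subst₂ _<_ (class-stable t _ t₁≤t) class≡ class<) class≤k)))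
        where
        t₁≤t : t₁ ≤ t
        t₁≤t = ≤-trans (m≤m+n t₁ (k + k)) t≥
        class≡ : class (r (suc (suc t)) v) ≡ class (r (suc t) v)
        class≡ = class-stable (suc t) v (m≤n⇒m≤1+n t₁≤t)

      settled : ∀ k → Settled k
      settled (suc k) t v t≥ class<
        rewrite +-suc k k | +-suc t₁ (suc (k + k)) | +-suc t₁ (k + k) with t | t≥ | class<
      ... | suc (suc t) | s≤s (s≤s t≥) | s≤s class≤k =
        offset≡ , trans (current-rule (suc (suc t)) v) (trans
          (currentRule-cong (view (suc (suc t)) v) (view (suc t) v) class≡ (seed-stable _ v t₀≤2+t) (previous-stable _ v t₀≤2+t)
            (time-stable _ v (m≤n⇒m≤1+n t₁≤1+t)) offset≡
            (λ i → seed-stable _ _ t₀≤1+t) (λ i → previous-stable _ _ t₀≤1+t) (λ i → time-stable _ _ t₁≤1+t)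
            (λ i class< → proj₂ (settled k (suc t) _ (m≤n⇒m≤1+n t≥) (<-≤-trans (earlier class<) class≤k)))
            (λ i class≡κ → offset-settles k (settled k) (suc t) _ (s≤s t≥)
               (s≤s (≤-trans (≤-reflexive (same class≡κ)) class≤k))))
          (sym (current-rule (suc t) v)))
        where
        t₁≤1+t : t₁ ≤ suc t
        t₁≤1+t = m≤n⇒m≤1+n (≤-trans (m≤m+n t₁ (k + k)) t≥)
        t₀≤1+t : t₀ ≤ suc t
        t₀≤1+t = ≤-trans t₀≤t₁ t₁≤1+t
        t₀≤2+t : t₀ ≤ suc (suc t)
        t₀≤2+t = m≤n⇒m≤1+n t₀≤1+t
        class≡ : class (r (suc (suc (suc t))) v) ≡ class (r (suc (suc t)) v)
        class≡ = class-stable _ v (m≤n⇒m≤1+n t₁≤1+t)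
        earlier : ∀ {u} → class (r (suc (suc t)) u) < class (r (suc (suc (suc t))) v) → class (r (suc t) u) < class (r (suc (suc t)) v)
        earlier = subst₂ _<_ (class-stable _ _ t₁≤1+t) class≡
        same : ∀ {u} → class (r (suc (suc t)) u) ≡ class (r (suc (suc (suc t))) v) → class (r (suc t) u) ≡ class (r (suc (suc t)) v)
        same e = trans (sym (class-stable _ _ t₁≤1+t)) (trans e class≡)
        offset≡ : offset (r (suc (suc (suc t))) v) ≡ offset (r (suc (suc t)) v)
        offset≡ = offset-settles k (settled k) (suc (suc t)) v (s≤s (m≤n⇒m≤1+n t≥)) (s≤s class≤k)

      t₂ : ℕ
      -- By `word-<` there are `2 ^ suc τ` classes.
      t₂ = t₁ + (2 ^ suc τ + 2 ^ suc τ)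

      offset-stable : Stable G t₂ (λ t v → offset (r t v))
      offset-stable t v t≥ = proj₁ (settled (2 ^ suc τ) t v t≥ (word-< τ _ _))

      current-stable : Stable G t₂ (λ t v → current (r t v))
      current-stable t v t≥ = proj₂ (settled (2 ^ suc τ) t v t≥ (word-< τ _ _))

-- Correctness of one pass at a fixed point.

χ-∧ : ∀ a b → χ (a ∧ b) ≡ χ a * χ b
χ-∧ true  b = sym (+-identityʳ (χ b))
χ-∧ false b = refl

∧-false⁻ : ∀ {a b} → a ∧ b ≡ false → a ≡ true → b ≡ false
∧-false⁻ e refl = e

true≢false : ∀ {b} → b ≡ true → b ≢ false
true≢false refl ()

-- Counting the vertex itself in `sparse` makes `M = 0` express that no vertex is left uncoloured.
record Partial {n : ℕ} (G : PortGraph n) (Δ M : ℕ) (c : Fin n → ℕ) : Set where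
  field
    proper : ∀ v i → c v ≤ Δ → c v ≢ c (nbr G v i)
    sparse : ∀ v → Δ < c v → suc (∑ (allFin (deg G v)) λ i → χ (Δ <ᵇ c (nbr G v i))) ≤ M
open Partial public

module PassCorrect (Δ τ ρ d α : ℕ) where
  open Pass Δ τ ρ d α

  -- A conflict has two sources: both words take the same value at stage `x`, or the own word meets
  -- the class that the neighbour already occupies. `word-meets` bounds the first and `word-takes`
  -- the second, each by `α` stages.
  conflict-total : ∀ {b s} u → capacity b τ ≤ α → s < 2 ^ b → seed u < 2 ^ b → s ≢ seed u →
    ∑ (upTo (2 ^ τ)) (λ x → χ (conflict s x u)) ≤ χ (uncoloured (previous u)) * (α + α)
  conflict-total {b} {s} u cap s< u< s≢u = begin
    ∑ (upTo (2 ^ τ)) (λ x → χ (conflict s x u))                                ≤⟨ ∑-mono (upTo (2 ^ τ)) split ⟩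
    ∑ (upTo (2 ^ τ)) (λ x → unc * (same x + kept x))                          ≡⟨ ∑-*ˡ (upTo (2 ^ τ)) unc _ ⟩
    unc * ∑ (upTo (2 ^ τ)) (λ x → same x + kept x)                            ≡⟨ cong (unc *_) (∑-+ (upTo (2 ^ τ)) same kept) ⟩
    unc * (∑ (upTo (2 ^ τ)) same + ∑ (upTo (2 ^ τ)) kept)                     ≤⟨ *-monoʳ-≤ unc (+-mono-≤ same≤ kept≤) ⟩
    unc * (α + α)                                                             ∎
    where
    open ≤-Reasoning
    unc = χ (uncoloured (previous u))
    same kept : ℕ → ℕ
    same x = χ ((word τ s x + 0) ≡ᵇ (word τ (seed u) x + 0))
    kept x = χ (word τ s x ≡ᵇ word τ (seed u) (time u))
    split : ∀ x → χ (conflict s x u) ≤ unc * (same x + kept x)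
    split x rewrite χ-∧ (uncoloured (previous u)) (word τ (seed u) (time u ⊓ x) ≡ᵇ word τ s x) =
      *-monoʳ-≤ unc (χ-≤ agree)
      where
      agree : (word τ (seed u) (time u ⊓ x) ≡ᵇ word τ s x) ≡ true → 1 ≤ same x + kept x
      agree e with ⊓-sel (time u) x
      ... | inj₁ m≡t rewrite m≡t = ≤-trans (≤-reflexive (cong χ (sym (≡ᵇ-true⁺ (sym (≡ᵇ-true⁻ {word τ (seed u) (time u)} e)))))) (m≤n+m _ (same x))
      ... | inj₂ m≡x rewrite m≡x = ≤-trans (≤-reflexive (cong χ (sym (≡ᵇ-true⁺ (cong (_+ 0) (sym (≡ᵇ-true⁻ {word τ (seed u) x} e))))))) (m≤m+n _ (kept x))
    same≤ : ∑ (upTo (2 ^ τ)) same ≤ α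
    same≤ = ≤-trans (word-meets s< u< s≢u (0<2^ (3 + τ)) (0<2^ (3 + τ))) cap
    kept≤ : ∑ (upTo (2 ^ τ)) kept ≤ α
    kept≤ = ≤-trans (word-takes s< (<-≤-trans (word-< τ (seed u) (time u)) (2^-mono-≤ (n≤m+n 2 (suc τ))))) cap
      where
      n≤m+n : ∀ m n → n ≤ m + n
      n≤m+n m n = m≤n+m n m

  offset-< : ∀ {j} → j ≤ 2 * Y → j < 2 ^ (3 + ρ)
  offset-< j≤ = ≤-<-trans j≤ (^-monoʳ-< 2 (s<s z<s) (n<1+n (2 + ρ)))

  -- A slice has at most one colour in each row, and two slices can share it only in rows where
  -- their words agree up to the shift given by `j` and `j′`.
  member-meets : ∀ {b s s′ j j′} → capacity b ρ ≤ α → s < 2 ^ b → s′ < 2 ^ b → s ≢ s′ → j ≤ 2 * Y → j′ ≤ 2 * Y →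
    Δ < 2 ^ ρ * Y → ∑ (upTo (suc Δ)) (λ z → χ (member s j z ∧ member s′ j′ z)) ≤ α
  member-meets {b} {s} {s′} {j} {j′} cap s< s′< s≢s′ j≤ j′≤ Δ< = begin
    ∑ (upTo (suc Δ)) (λ z → χ (both z))                                          ≤⟨ ∑-mono∈ (upTo (suc Δ)) locate ⟩
    ∑ (upTo (suc Δ)) (λ z → ∑ (upTo (2 ^ ρ)) λ x → χ (both z ∧ (z / Y ≡ᵇ x)))  ≡⟨ ∑-swap (upTo (suc Δ)) (upTo (2 ^ ρ)) _ ⟩
    ∑ (upTo (2 ^ ρ)) (λ x → ∑ (upTo (suc Δ)) λ z → χ (both z ∧ (z / Y ≡ᵇ x)))  ≤⟨ ∑-mono (upTo (2 ^ ρ)) row ⟩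
    ∑ (upTo (2 ^ ρ)) (λ x → χ ((word ρ s x + j′) ≡ᵇ (word ρ s′ x + j)))        ≤⟨ word-meets s< s′< s≢s′ (offset-< j≤) (offset-< j′≤) ⟩
    capacity b ρ                                                                ≤⟨ cap ⟩
    α                                                                           ∎
    where
    open ≤-Reasoning
    both : ℕ → Bool
    both z = member s j z ∧ member s′ j′ z
    locate : ∀ z → z ∈ upTo (suc Δ) → χ (both z) ≤ ∑ (upTo (2 ^ ρ)) λ x → χ (both z ∧ (z / Y ≡ᵇ x))
    locate z z∈ = ≤-trans
      (χ-mono {both z} λ e → ∧-true⁺ e (≡ᵇ-true⁺ {z / Y} refl))
      (∑-∈-≤ (λ x → χ (both z ∧ (z / Y ≡ᵇ x))) (∈-upTo⁺ {2 ^ ρ} (m<n*o⇒m/o<n {z} {2 ^ ρ} {Y} (≤-<-trans (s≤s⁻¹ (∈-upTo⁻ z∈)) Δ<))))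
    memberˡ : ∀ {z x} → both z ∧ (z / Y ≡ᵇ x) ≡ true → z % Y + j ≡ word ρ s x + Y
    memberˡ {z} e with ∧-true⁻ {both z} e
    ... | b , at rewrite sym (≡ᵇ-true⁻ {z / Y} at) = ≡ᵇ-true⁻ {z % Y + j} (proj₁ (∧-true⁻ {member s j z} b))
    memberʳ : ∀ {z x} → both z ∧ (z / Y ≡ᵇ x) ≡ true → z % Y + j′ ≡ word ρ s′ x + Y
    memberʳ {z} e with ∧-true⁻ {both z} e
    ... | b , at rewrite sym (≡ᵇ-true⁻ {z / Y} at) = ≡ᵇ-true⁻ {z % Y + j′} (proj₂ (∧-true⁻ {member s j z} b))
    in-row : ∀ {z x} → both z ∧ (z / Y ≡ᵇ x) ≡ true → z / Y ≡ x
    in-row {z} e = ≡ᵇ-true⁻ {z / Y} (proj₂ (∧-true⁻ {both z} e))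
    only : ∀ x {z z′} → both z ∧ (z / Y ≡ᵇ x) ≡ true → both z′ ∧ (z′ / Y ≡ᵇ x) ≡ true → z ≡ z′
    only x {z} {z′} e e′ = begin-equality
      z                     ≡⟨ m≡m%n+[m/n]*n z Y ⟩
      z % Y + z / Y * Y     ≡⟨ cong₂ (λ p q → p + q * Y) columns (trans (in-row {z} e) (sym (in-row {z′} e′))) ⟩
      z′ % Y + z′ / Y * Y   ≡⟨ m≡m%n+[m/n]*n z′ Y ⟨
      z′                    ∎
      where
      columns : z % Y ≡ z′ % Y
      columns = +-cancelʳ-≡ j (z % Y) (z′ % Y) (trans (memberˡ {z} e) (sym (memberˡ {z′} e′)))
    agree : ∀ {z x} → both z ∧ (z / Y ≡ᵇ x) ≡ true → word ρ s x + j′ ≡ word ρ s′ x + j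
    agree {z} {x} e = +-cancelˡ-≡ Y (word ρ s x + j′) (word ρ s′ x + j) (begin-equality
      Y + (word ρ s x + j′)    ≡⟨ lemma Y (word ρ s x) j′ ⟩
      word ρ s x + Y + j′      ≡⟨ cong (_+ j′) (memberˡ {z} e) ⟨
      z % Y + j + j′           ≡⟨ lemma′ (z % Y) j j′ ⟩
      z % Y + j′ + j           ≡⟨ cong (_+ j) (memberʳ {z} e) ⟩
      word ρ s′ x + Y + j      ≡⟨ lemma Y (word ρ s′ x) j ⟨
      Y + (word ρ s′ x + j)    ∎)
      where
      lemma : ∀ a b c → a + (b + c) ≡ b + a + c
      lemma a b c = solve (a ∷ b ∷ c ∷ [])
      lemma′ : ∀ a b c → a + b + c ≡ a + c + b
      lemma′ a b c = solve (a ∷ b ∷ c ∷ [])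
    row : ∀ x → ∑ (upTo (suc Δ)) (λ z → χ (both z ∧ (z / Y ≡ᵇ x))) ≤ χ ((word ρ s x + j′) ≡ᵇ (word ρ s′ x + j))
    row x with (word ρ s x + j′) ≡ᵇ (word ρ s′ x + j) in e
    ... | true  = ∑-upTo-≤1 (suc Δ) (λ z → both z ∧ (z / Y ≡ᵇ x)) (λ {z} {z′} → only x {z} {z′})
    ... | false = ≤-trans (∑-mono (upTo (suc Δ)) {g = λ _ → 0} (λ z → χ-≤ {both z ∧ (z / Y ≡ᵇ x)} λ t →
                    contradiction e (true≢false (≡ᵇ-true⁺ (agree {z} t))))) (≤-reflexive (∑-0 (upTo (suc Δ))))

  -- The slice through `z` is found by solving the equation of `member` for `j`; the added `Y` keeps
  -- the subtraction from being truncated.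
  member-covers : ∀ s z → 1 ≤ ∑ (upTo (2 * Y)) (λ j → χ (member s j z))
  member-covers s z = ≤-trans
    (≤-reflexive (cong χ (sym (≡ᵇ-true⁺ (m+[n∸m]≡n column≤)))))
    (∑-∈-≤ (λ j → χ (member s j z)) (∈-upTo⁺ j<))
    where
    open ≤-Reasoning
    g = word ρ s (z / Y)
    column≤ : z % Y ≤ g + Y
    column≤ = ≤-trans (<⇒≤ (m%n<n z Y)) (m≤n+m Y g)
    j< : g + Y ∸ z % Y < 2 * Y
    j< = begin-strict
      g + Y ∸ z % Y ≤⟨ m∸n≤m (g + Y) (z % Y) ⟩
      g + Y         <⟨ +-monoˡ-< Y (word-< ρ s (z / Y)) ⟩
      Y + Y         ≡⟨ cong (Y +_) (+-identityʳ Y) ⟨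
      2 * Y         ∎

  module _ {n : ℕ} (G : PortGraph n) (R : Fin n → Report) (b M : ℕ) where

    around : ∀ v → Fin (deg G v) → Report
    around v i = R (nbr G v i)

    κ : Fin n → ℕ
    κ v = class (R v)

    module _
      (deg≤Δ      : ∀ v → deg G v ≤ Δ)
      (capτ       : capacity b τ ≤ α)
      (capρ       : capacity b ρ ≤ α)
      (palette    : Δ < 2 ^ ρ * Y)
      (enough     : M * (α + α) ≤ suc d * 2 ^ τ)
      (seeds      : Proper G b (seed ∘ R))
      (before     : Partial G Δ M (previous ∘ R))
      (time-eq    : ∀ v → time (R v) ≡ timeRule (seed (R v)) (around v))
      (offset-eq  : ∀ v → offset (R v) ≡ offsetRule (κ v) (seed (R v)) (around v))
      (current-eq : ∀ v → current (R v) ≡ currentRule (κ v) (seed (R v)) (previous (R v)) (time (R v)) (offset (R v)) (around v))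
      where

      0<α : 0 < α
      0<α = <-≤-trans z<s capτ

      -- Pigeonhole over the `2 ^ τ` stages: if each had more than `d` conflicts, their total would
      -- reach `suc d * 2 ^ τ`, but the `U` uncoloured neighbours cause at most `U * (α + α)`.
      -- Strictness comes from `suc U ≤ M`.
      in-class-few : ∀ v → Δ < previous (R v) → count (conflict (seed (R v)) (time (R v))) (around v) ≤ d
      in-class-few v unc rewrite time-eq v with searched (2 ^ τ) (λ x → count (conflict (seed (R v)) x) (around v) ≤ᵇ d)
      ... | found _ few _ = ≤ᵇ-true⁻ few
      ... | absent _ many = contradiction total (<⇒≱ few)
        where
        open ≤-Reasoning
        s = seed (R v)
        U = ∑ (allFin (deg G v)) λ i → χ (Δ <ᵇ previous (R (nbr G v i)))
        few : U * (α + α) < suc d * 2 ^ τ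
        few = begin-strict
          U * (α + α)           <⟨ *-monoˡ-< (α + α) {{>-nonZero (≤-trans 0<α (m≤m+n α α))}} (n<1+n U) ⟩
          suc U * (α + α)       ≤⟨ *-monoˡ-≤ (α + α) (sparse before v unc) ⟩
          M * (α + α)           ≤⟨ enough ⟩
          suc d * 2 ^ τ         ∎
        total : suc d * 2 ^ τ ≤ U * (α + α)
        total = begin
          suc d * 2 ^ τ                                                   ≡⟨ *-comm (suc d) (2 ^ τ) ⟩
          2 ^ τ * suc d                                                   ≡⟨ ∑-upTo-const (2 ^ τ) (suc d) ⟨
          ∑ (upTo (2 ^ τ)) (λ _ → suc d)
            ≤⟨ ∑-mono∈ (upTo (2 ^ τ)) (λ x x∈ → ≤ᵇ-false⁻ (many (∈-upTo⁻ x∈))) ⟩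
          ∑ (upTo (2 ^ τ)) (λ x → count (conflict s x) (around v))         ≡⟨ ∑-swap (upTo (2 ^ τ)) (allFin (deg G v)) _ ⟩
          ∑ (allFin (deg G v)) (λ i → ∑ (upTo (2 ^ τ)) λ x → χ (conflict s x (around v i)))
            ≤⟨ ∑-mono (allFin (deg G v)) (λ i → conflict-total (around v i) capτ (bounded seeds v) (bounded seeds _) (distinct seeds v i)) ⟩
          ∑ (allFin (deg G v)) (λ i → χ (uncoloured (previous (around v i))) * (α + α))  ≡⟨ ∑-*ʳ (allFin (deg G v)) (α + α) _ ⟩
          U * (α + α)                                                     ∎

      -- A neighbour in the same class that joined no later has its final class by the own joining
      -- stage, so the conflict test counted it.
      ahead-few : ∀ v → Δ < previous (R v) → count (ahead (κ v) (time (R v))) (around v) ≤ d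
      ahead-few v unc = ≤-trans (∑-mono (allFin (deg G v)) λ i → χ-mono (conflicting i)) (in-class-few v unc)
        where
        conflicting : ∀ i → ahead (κ v) (time (R v)) (around v i) ≡ true → conflict (seed (R v)) (time (R v)) (around v i) ≡ true
        conflicting i e with ∧-true⁻ {uncoloured (previous (around v i))} e
        ... | unc′ , e′ with ∧-true⁻ {class (around v i) ≡ᵇ κ v} e′
        ...   | same , time≤ rewrite m≤n⇒m⊓n≡m (≤ᵇ-true⁻ {time (around v i)} time≤) = ∧-true⁺ unc′ same

      keeps : ∀ v → previous (R v) ≤ Δ → current (R v) ≡ previous (R v)
      keeps v p≤Δ = trans (current-eq v) (cong (λ b → if b then search (suc Δ) (admissible (κ v) (seed (R v)) (time (R v)) (offset (R v)) (around v)) else previous (R v)) (<ᵇ-false⁺ p≤Δ))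

      picks : Fin n → ℕ → Bool
      picks v = admissible (κ v) (seed (R v)) (time (R v)) (offset (R v)) (around v)

      current-search : ∀ v → Δ < previous (R v) → current (R v) ≡ search (suc Δ) (picks v)
      current-search v unc = trans (current-eq v) (cong (λ b → if b then search (suc Δ) (picks v) else previous (R v)) (<ᵇ-true⁺ unc))

      chosen : ∀ v → Δ < previous (R v) → current (R v) ≤ Δ → picks v (current (R v)) ≡ true
      chosen v unc c≤Δ rewrite current-search v unc with searched (suc Δ) (picks v)
      ... | found _ ok _ = ok
      ... | absent e _   = contradiction (≤-trans (≤-reflexive (sym e)) c≤Δ) 1+n≰n

      failed : ∀ v → Δ < current (R v) → Δ < previous (R v) × (∀ {z} → z ≤ Δ → picks v z ≡ false)
      failed v Δ<c with previous (R v) ≤? Δ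
      ... | yes p≤Δ = contradiction (subst (_≤ Δ) (sym (keeps v p≤Δ)) p≤Δ) (<⇒≱ Δ<c)
      ... | no  p≰Δ with searched (suc Δ) (picks v)
      ...   | found m< _ _  = contradiction (subst (_≤ Δ) (sym (current-search v (≰⇒> p≰Δ))) (s≤s⁻¹ m<)) (<⇒≱ Δ<c)
      ...   | absent _ none = ≰⇒> p≰Δ , λ z≤Δ → none (s≤s z≤Δ)

      picks-free : ∀ v z → picks v z ≡ true → ∀ i → blocks (κ v) z (around v i) ≡ false
      picks-free v z e i = ∑χ≡0⇒false (λ i → blocks (κ v) z (around v i))
        (≡ᵇ-true⁻ (proj₁ (∧-true⁻ {free (κ v) (around v) z} e))) (∈-allFin i)

      picks-member : ∀ v z → picks v z ≡ true → member (seed (R v)) (offset (R v)) z ≡ true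
      picks-member v z e = proj₁ (∧-true⁻ {member (seed (R v)) (offset (R v)) z} (proj₂ (∧-true⁻ {free (κ v) (around v) z} e)))

      picks-unrivalled : ∀ v z → picks v z ≡ true → ∀ i → rival (κ v) (time (R v)) z (around v i) ≡ false
      picks-unrivalled v z e i = ∑χ≡0⇒false (λ i → rival (κ v) (time (R v)) z (around v i))
        (≡ᵇ-true⁻ (proj₂ (∧-true⁻ {member (seed (R v)) (offset (R v)) z} (proj₂ (∧-true⁻ {free (κ v) (around v) z} e))))) (∈-allFin i)

      Earlier : Fin n → Fin n → Set
      Earlier u v = previous (R u) ≤ Δ ⊎ (Δ < previous (R u) × (κ u < κ v ⊎ (κ u ≡ κ v × time (R u) ≤ time (R v))))

      -- Only the later vertex has to take care. A neighbour coloured before the pass or in a lower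
      -- class blocks its colour; against a neighbour ahead in the same class the slices decide.
      no-clash : ∀ {u v} → Adjacent G v u → Δ < previous (R v) → current (R v) ≤ Δ → Earlier u v → current (R v) ≢ current (R u)
      no-clash {v = v} (i , refl) unc c≤Δ (inj₁ p≤Δ) e =
        true≢false (cong (_∨ ((class (around v i) <ᵇ κ v) ∧ (current (around v i) ≡ᵇ current (R v)))) (≡ᵇ-true⁺ (trans (sym (keeps _ p≤Δ)) (sym e)))) (picks-free v _ (chosen v unc c≤Δ) i)
      no-clash {v = v} (i , refl) unc c≤Δ (inj₂ (_ , inj₁ κ<κ)) e =
        true≢false (trans (cong ((previous (around v i) ≡ᵇ current (R v)) ∨_) (∧-true⁺ (<ᵇ-true⁺ κ<κ) (≡ᵇ-true⁺ (sym e)))) (∨-zeroʳ _)) (picks-free v _ (chosen v unc c≤Δ) i)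
      no-clash {v = v} (i , refl) unc c≤Δ (inj₂ (unc′ , inj₂ (κ≡κ , t≤t))) e =
        true≢false (∧-true⁺ (∧-true⁺ (<ᵇ-true⁺ unc′) (∧-true⁺ (≡ᵇ-true⁺ κ≡κ) (≤ᵇ-true⁺ t≤t))) member-u)
                   (picks-unrivalled v _ (chosen v unc c≤Δ) i)
        where
        u = nbr G v i
        -- The colour of `u` lies in the slice of `u`, and `v` avoids that slice.
        member-u : member (seed (R u)) (offset (R u)) (current (R v)) ≡ true
        member-u = subst (λ z → member (seed (R u)) (offset (R u)) z ≡ true) (sym e) (picks-member u _ (chosen u unc′ (subst (_≤ Δ) e c≤Δ)))

      after-proper : ∀ v i → current (R v) ≤ Δ → current (R v) ≢ current (R (nbr G v i))
      after-proper v i c≤Δ e with previous (R v) ≤? Δ | previous (R (nbr G v i)) ≤? Δ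
      ... | yes p | yes q = proper before v i p (trans (sym (keeps v p)) (trans e (keeps _ q)))
      ... | no  p | yes q = no-clash {nbr G v i} {v} (i , refl) (≰⇒> p) c≤Δ (inj₁ q) e
      ... | yes p | no  q = no-clash {v} {nbr G v i} (back G v i , back-correct G v i) (≰⇒> q) (subst (_≤ Δ) e c≤Δ) (inj₁ p) (sym e)
      ... | no  p | no  q with <-cmp (κ (nbr G v i)) (κ v) | ≤-total (time (R (nbr G v i))) (time (R v))
      ...   | tri< κ< _ _ | _       = no-clash {nbr G v i} {v} (i , refl) (≰⇒> p) c≤Δ (inj₂ (≰⇒> q , inj₁ κ<)) e
      ...   | tri≈ _ κ≡ _ | inj₁ t≤ = no-clash {nbr G v i} {v} (i , refl) (≰⇒> p) c≤Δ (inj₂ (≰⇒> q , inj₂ (κ≡ , t≤))) e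
      ...   | tri≈ _ κ≡ _ | inj₂ t≥ = no-clash {v} {nbr G v i} (back G v i , back-correct G v i) (≰⇒> q) (subst (_≤ Δ) e c≤Δ)
                                        (inj₂ (≰⇒> p , inj₂ (sym κ≡ , t≥))) (sym e)
      ...   | tri> _ _ κ> | _       = no-clash {v} {nbr G v i} (back G v i , back-correct G v i) (≰⇒> q) (subst (_≤ Δ) e c≤Δ)
                                        (inj₂ (≰⇒> p , inj₁ κ>)) (sym e)

      offset-≤ : ∀ v → offset (R v) ≤ 2 * Y
      offset-≤ v rewrite offset-eq v = search-≤ (2 * Y) _

      usable : Fin n → ℕ → ℕ
      usable v j = ∑ (upTo (suc Δ)) λ z → χ (free (κ v) (around v) z ∧ member (seed (R v)) j z)

      -- For a failed vertex, every free colour in its slice lies in the slice of one of the at most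
      -- `d` neighbours ahead, and each of these shares at most `α` colours with it.
      usable-≤ : ∀ v → Δ < current (R v) → usable v (offset (R v)) ≤ d * α
      usable-≤ v Δ<c = begin
        usable v j                                                                 ≤⟨ ∑-mono∈ (upTo (suc Δ)) rivalled ⟩
        ∑ (upTo (suc Δ)) (λ z → ∑ (allFin (deg G v)) λ i → hits i z)               ≡⟨ ∑-swap (upTo (suc Δ)) (allFin (deg G v)) _ ⟩
        ∑ (allFin (deg G v)) (λ i → ∑ (upTo (suc Δ)) (hits i))                     ≤⟨ ∑-mono (allFin (deg G v)) few-hits ⟩
        ∑ (allFin (deg G v)) (λ i → χ (front i) * α)                               ≡⟨ ∑-*ʳ (allFin (deg G v)) α _ ⟩
        count (ahead (κ v) (time (R v))) (around v) * α                             ≤⟨ *-monoˡ-≤ α (ahead-few v (proj₁ (failed v Δ<c))) ⟩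
        d * α                                                                      ∎
        where
        open ≤-Reasoning
        j = offset (R v)
        s = seed (R v)
        front : Fin (deg G v) → Bool
        front i = ahead (κ v) (time (R v)) (around v i)
        theirs : Fin (deg G v) → ℕ → Bool
        theirs i z = member (seed (around v i)) (offset (around v i)) z
        hits : Fin (deg G v) → ℕ → ℕ
        hits i z = χ (front i) * χ (member s j z ∧ theirs i z)
        few-hits : ∀ i → ∑ (upTo (suc Δ)) (hits i) ≤ χ (front i) * α
        few-hits i = ≤-trans (≤-reflexive (∑-*ˡ (upTo (suc Δ)) (χ (front i)) _)) (*-monoʳ-≤ (χ (front i))
          (member-meets capρ (bounded seeds v) (bounded seeds _) (distinct seeds v i) (offset-≤ v) (offset-≤ _) palette))
        rivalled : ∀ z → z ∈ upTo (suc Δ) → χ (free (κ v) (around v) z ∧ member s j z) ≤ ∑ (allFin (deg G v)) λ i → hits i z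
        rivalled z z∈ = χ-≤ λ e → let fr , me = ∧-true⁻ {free (κ v) (around v) z} e in ≤-trans
          (≡ᵇ0-false⁻ (∧-false⁻ (∧-false⁻ (proj₂ (failed v Δ<c) (s≤s⁻¹ (∈-upTo⁻ z∈))) fr) me))
          (∑-mono (allFin (deg G v)) λ i → ≤-trans (≤-reflexive (χ-∧ (front i) (theirs i z)))
            (*-monoʳ-≤ (χ (front i)) (χ-mono (∧-true⁺ me))))

      -- If some slice had more than `d * α` free colours, such a slice would have been selected,
      -- against `usable-≤`. So failure limits every slice, not only the selected one.
      no-offset : ∀ v → Δ < current (R v) → ∀ {j} → j < 2 * Y → usable v j ≤ d * α
      no-offset v Δ<c j< with searched (2 * Y) (λ j → d * α <ᵇ usable v j)
      ... | absent _ none   = <ᵇ-false⁻ (none j<)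
      ... | found _ plenty _ = contradiction (subst (λ j → usable v j ≤ d * α) (offset-eq v) (usable-≤ v Δ<c)) (<⇒≱ (<ᵇ-true⁻ plenty))

      frees : Fin n → ℕ
      frees v = ∑ (upTo (suc Δ)) λ z → χ (free (κ v) (around v) z)

      frees-≤ : ∀ v → Δ < current (R v) → frees v ≤ 2 * Y * (d * α)
      frees-≤ v Δ<c = begin
        frees v                                                                             ≤⟨ ∑-mono (upTo (suc Δ)) covered ⟩
        ∑ (upTo (suc Δ)) (λ z → ∑ (upTo (2 * Y)) λ j → χ (free (κ v) (around v) z ∧ member s j z))  ≡⟨ ∑-swap (upTo (suc Δ)) (upTo (2 * Y)) _ ⟩
        ∑ (upTo (2 * Y)) (usable v)                                                         ≤⟨ ∑-mono∈ (upTo (2 * Y)) (λ j j∈ → no-offset v Δ<c (∈-upTo⁻ j∈)) ⟩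
        ∑ (upTo (2 * Y)) (λ _ → d * α)                                                      ≡⟨ ∑-upTo-const (2 * Y) (d * α) ⟩
        2 * Y * (d * α)                                                                     ∎
        where
        open ≤-Reasoning
        s = seed (R v)
        covered : ∀ z → χ (free (κ v) (around v) z) ≤ ∑ (upTo (2 * Y)) λ j → χ (free (κ v) (around v) z ∧ member s j z)
        covered z = χ-≤ λ e → ≤-trans (member-covers s z) (∑-mono (upTo (2 * Y)) λ j → χ-mono (∧-true⁺ e))

      owner : ∀ κ v {z} → z ≤ Δ → blocks κ z (R v) ≡ true → current (R v) ≡ z
      owner κ v {z} z≤Δ e with previous (R v) ≡ᵇ z in p≡z
      ... | true  = trans (keeps v (subst (_≤ Δ) (sym (≡ᵇ-true⁻ p≡z)) z≤Δ)) (≡ᵇ-true⁻ p≡z)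
      ... | false = ≡ᵇ-true⁻ (proj₂ (∧-true⁻ {class (R v) <ᵇ κ} e))

      -- A vertex can block only the colour it ends with, and blocks none if it stays uncoloured.
      blocked-once : ∀ κ v → ∑ (upTo (suc Δ)) (λ z → χ (blocks κ z (R v))) + χ (uncoloured (current (R v))) ≤ 1
      blocked-once κ v with Δ <ᵇ current (R v) in unc
      ... | true  = +-monoˡ-≤ 1 (≤-trans (∑-mono∈ (upTo (suc Δ)) {g = λ _ → 0} unowned) (≤-reflexive (∑-0 (upTo (suc Δ)))))
        where
        unowned : ∀ z → z ∈ upTo (suc Δ) → χ (blocks κ z (R v)) ≤ 0
        unowned z z∈ = χ-≤ λ e → contradiction
          (subst (_≤ Δ) (sym (owner κ v (s≤s⁻¹ (∈-upTo⁻ z∈)) e)) (s≤s⁻¹ (∈-upTo⁻ z∈))) (<⇒≱ (<ᵇ-true⁻ unc))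
      ... | false = ≤-trans (≤-reflexive (+-identityʳ _)) (≤-trans
          (∑-mono∈ (upTo (suc Δ)) {g = λ z → χ (current (R v) ≡ᵇ z)} λ z z∈ → χ-mono {blocks κ z (R v)} λ e → ≡ᵇ-true⁺ (owner κ v (s≤s⁻¹ (∈-upTo⁻ z∈)) e))
          (∑-upTo-≤1 (suc Δ) (current (R v) ≡ᵇ_) λ p q → trans (sym (≡ᵇ-true⁻ {current (R v)} p)) (≡ᵇ-true⁻ q)))

      -- Each neighbour uses up at most one colour or stays uncoloured, never both. So `suc Δ`
      -- colours against at most `Δ` neighbours leave more free colours than uncoloured neighbours.
      after-sparse : ∀ v → Δ < current (R v) → suc (∑ (allFin (deg G v)) λ i → χ (Δ <ᵇ current (R (nbr G v i)))) ≤ 2 * Y * (d * α)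
      after-sparse v Δ<c = ≤-trans (+-cancelˡ-≤ Δ (suc U) (frees v) (begin
        Δ + suc U                                                   ≡⟨ +-suc Δ U ⟩
        suc Δ + U                                                   ≤⟨ +-monoˡ-≤ U every ⟩
        frees v + ∑ (allFin (deg G v)) blocked + U                  ≡⟨ +-assoc (frees v) _ U ⟩
        frees v + (∑ (allFin (deg G v)) blocked + U)                ≤⟨ +-monoʳ-≤ (frees v) once ⟩
        frees v + Δ                                                 ≡⟨ +-comm (frees v) Δ ⟩
        Δ + frees v                                                 ∎)) (frees-≤ v Δ<c)
        where
        open ≤-Reasoning
        U = ∑ (allFin (deg G v)) λ i → χ (Δ <ᵇ current (R (nbr G v i)))
        blocked : Fin (deg G v) → ℕ
        blocked i = ∑ (upTo (suc Δ)) λ z → χ (blocks (κ v) z (around v i))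
        every : suc Δ ≤ frees v + ∑ (allFin (deg G v)) blocked
        every = begin
          suc Δ                                                     ≡⟨ *-identityʳ (suc Δ) ⟨
          suc Δ * 1                                                 ≡⟨ ∑-upTo-const (suc Δ) 1 ⟨
          ∑ (upTo (suc Δ)) (λ _ → 1)                                ≤⟨ ∑-mono (upTo (suc Δ)) (λ z → some (count (blocks (κ v) z) (around v))) ⟩
          ∑ (upTo (suc Δ)) (λ z → χ (free (κ v) (around v) z) + count (blocks (κ v) z) (around v))
                                                                    ≡⟨ ∑-+ (upTo (suc Δ)) (λ z → χ (free (κ v) (around v) z)) (λ z → count (blocks (κ v) z) (around v)) ⟩
          frees v + ∑ (upTo (suc Δ)) (λ z → count (blocks (κ v) z) (around v))
                                                                    ≡⟨ cong (frees v +_) (∑-swap (upTo (suc Δ)) (allFin (deg G v)) _) ⟩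
          frees v + ∑ (allFin (deg G v)) blocked                    ∎
          where
          some : ∀ m → 1 ≤ χ (m ≡ᵇ 0) + m
          some zero    = ≤-refl
          some (suc m) = s≤s z≤n
        once : ∑ (allFin (deg G v)) blocked + U ≤ Δ
        once = begin
          ∑ (allFin (deg G v)) blocked + U                          ≡⟨ ∑-+ (allFin (deg G v)) blocked _ ⟨
          ∑ (allFin (deg G v)) (λ i → blocked i + χ (Δ <ᵇ current (R (nbr G v i))))
                                                                    ≤⟨ ∑-mono (allFin (deg G v)) (λ i → blocked-once (κ v) (nbr G v i)) ⟩
          ∑ (allFin (deg G v)) (λ _ → 1)                            ≡⟨ ∑-const (allFin (deg G v)) 1 ⟩
          length (allFin (deg G v)) * 1                             ≡⟨ trans (*-identityʳ _) (length-allFin (deg G v)) ⟩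
          deg G v                                                   ≤⟨ deg≤Δ v ⟩
          Δ                                                         ∎

      pass-partial : Partial G Δ (2 * Y * (d * α)) (current ∘ R)
      pass-partial = record { proper = after-proper ; sparse = after-sparse }

-- Several passes in succession.

PassState : Set
PassState = ℕ × ℕ × ℕ

toReport : ℕ → ℕ → PassState → Report
toReport s p (x , j , c) = report s p x j c

outcome : PassState → ℕ
outcome (x , j , c) = c

PassesState : List ℕ → Set
PassesState []       = ⊤
PassesState (d ∷ ds) = PassState × PassesState ds

passesOut : ∀ ds → ℕ → PassesState ds → ℕ
passesOut []       p _       = p
passesOut (d ∷ ds) p (q , r) = passesOut ds (outcome q) r

module Passes (Δ τ ρ α : ℕ) where

  passRule : ∀ {δ} → ℕ → ℕ → ℕ → (Fin δ → Report) → PassState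
  passRule d s p us = x , j , currentRule κ s p x j us
    where
    open Pass Δ τ ρ d α
    x = timeRule s us
    κ = word τ s x
    j = offsetRule κ s us

  passesRule : ∀ {δ} ds → ℕ → ℕ → (Fin δ → ℕ) → (Fin δ → ℕ) → (Fin δ → PassesState ds) → PassesState ds
  passesRule []       s p S P R = tt
  passesRule (d ∷ ds) s p S P R = q , passesRule ds s (outcome q) S (outcome ∘ proj₁ ∘ R) (proj₂ ∘ R)
    where q = passRule d s p λ i → toReport (S i) (P i) (proj₁ (R i))

  residue : List ℕ → ℕ → ℕ
  residue []       M = M
  residue (d ∷ ds) M = residue ds (2 * 2 ^ suc ρ * (d * α))

  Feasible : List ℕ → ℕ → Set
  Feasible []       M = ⊤
  Feasible (d ∷ ds) M = M * (α + α) ≤ suc d * 2 ^ τ × Feasible ds (2 * 2 ^ suc ρ * (d * α))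

  duration : List ℕ → ℕ
  duration []       = 0
  duration (d ∷ ds) = 2 ^ τ + (2 ^ suc τ + 2 ^ suc τ) + duration ds

  module _ {n : ℕ} (G : PortGraph n) (b : ℕ) (deg≤Δ : ∀ v → deg G v ≤ Δ)
           (capτ : capacity b τ ≤ α) (capρ : capacity b ρ ≤ α) (palette : Δ < 2 ^ ρ * 2 ^ suc ρ)
           (s : Signal G) where

    -- Once all is stable, the neighbours' records of the last round are the present ones, and the
    -- rules become equations about a single configuration, to which `pass-partial` applies.
    pass-stable : ∀ d M t₀ (p : Signal G) (q : ℕ → Fin n → PassState) →
      (∀ t v → q (suc t) v ≡ passRule d (s (suc t) v) (p (suc t) v) (λ i → toReport (s t (nbr G v i)) (p t (nbr G v i)) (q t (nbr G v i)))) →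
      Stable G t₀ s → (∀ t → t₀ ≤ t → Proper G b (s t)) →
      Stable G t₀ p → (∀ t → t₀ ≤ t → Partial G Δ M (p t)) →
      M * (α + α) ≤ suc d * 2 ^ τ →
      Stable G (t₀ + (2 ^ τ + (2 ^ suc τ + 2 ^ suc τ))) (λ t v → outcome (q t v)) ×
      (∀ t → t₀ + (2 ^ τ + (2 ^ suc τ + 2 ^ suc τ)) ≤ t → Partial G Δ (2 * 2 ^ suc ρ * (d * α)) (λ v → outcome (q t v)))
    pass-stable d M t₀ p q rule s-stable s-proper p-stable p-partial enough
      rewrite sym (+-assoc t₀ (2 ^ τ) (2 ^ suc τ + 2 ^ suc τ)) = current-stable , partial
      where
      open Pass Δ τ ρ d α
      r : ℕ → Fin n → Report
      r t v = toReport (s t v) (p t v) (q t v)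
      time-rule : ∀ t v → time (r (suc t) v) ≡ timeRule (seed (r (suc t) v)) (view G r t v)
      time-rule t v rewrite rule t v = refl
      offset-rule : ∀ t v → offset (r (suc t) v) ≡ offsetRule (class (r (suc t) v)) (seed (r (suc t) v)) (view G r t v)
      offset-rule t v rewrite rule t v = refl
      current-rule : ∀ t v → current (r (suc t) v) ≡ currentRule (class (r (suc t) v)) (seed (r (suc t) v))
                       (previous (r (suc t) v)) (time (r (suc t) v)) (offset (r (suc t) v)) (view G r t v)
      current-rule t v rewrite rule t v = refl
      obeys : Obeys G r
      obeys = record { time-rule = time-rule ; offset-rule = offset-rule ; current-rule = current-rule }
      open Stabilise G r obeys {t₀} s-stable p-stable
      partial : ∀ t → t₂ ≤ t → Partial G Δ (2 * 2 ^ suc ρ * (d * α)) (λ v → outcome (q t v))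
      partial t t₂≤t = PassCorrect.pass-partial Δ τ ρ d α G (r t) b M deg≤Δ capτ capρ palette enough
        (s-proper t t₀≤t) (p-partial t t₀≤t) fixed-time fixed-offset fixed-current
        where
        t₁≤t : t₁ ≤ t
        t₁≤t = ≤-trans (m≤m+n t₁ _) t₂≤t
        t₀≤t : t₀ ≤ t
        t₀≤t = ≤-trans t₀≤t₁ t₁≤t
        fixed-time : ∀ v → time (r t v) ≡ timeRule (seed (r t v)) (view G r t v)
        fixed-time v = trans (sym (time-stable t v t₁≤t)) (trans (time-rule t v)
          (cong (λ s′ → timeRule s′ (view G r t v)) (s-stable t v t₀≤t)))
        fixed-offset : ∀ v → offset (r t v) ≡ offsetRule (class (r t v)) (seed (r t v)) (view G r t v)
        fixed-offset v = trans (sym (offset-stable t v t₂≤t)) (trans (offset-rule t v)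
          (cong₂ (λ κ s′ → offsetRule κ s′ (view G r t v)) (class-stable t v t₁≤t) (s-stable t v t₀≤t)))
        fixed-current : ∀ v → current (r t v) ≡ currentRule (class (r t v)) (seed (r t v)) (previous (r t v)) (time (r t v)) (offset (r t v)) (view G r t v)
        fixed-current v = trans (sym (current-stable t v t₂≤t)) (trans (current-rule t v) (trans
          (cong₂ (λ κ s′ → currentRule κ s′ (p (suc t) v) (time (r (suc t) v)) (offset (r (suc t) v)) (view G r t v))
            (class-stable t v t₁≤t) (s-stable t v t₀≤t)) (trans
          (cong₂ (λ p′ x → currentRule (class (r t v)) (s t v) p′ x (offset (r (suc t) v)) (view G r t v))
            (p-stable t v t₀≤t) (time-stable t v t₁≤t))
          (cong (λ j → currentRule (class (r t v)) (s t v) (p t v) (time (r t v)) j (view G r t v)) (offset-stable t v t₂≤t)))))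

    passes-stable : ∀ ds M t₀ (p : Signal G) (st : ℕ → Fin n → PassesState ds) →
      (∀ t v → st (suc t) v ≡ passesRule ds (s (suc t) v) (p (suc t) v) (λ i → s t (nbr G v i)) (λ i → p t (nbr G v i)) (λ i → st t (nbr G v i))) →
      Stable G t₀ s → (∀ t → t₀ ≤ t → Proper G b (s t)) →
      Stable G t₀ p → (∀ t → t₀ ≤ t → Partial G Δ M (p t)) → Feasible ds M →
      ∀ t → t₀ + duration ds ≤ t → Partial G Δ (residue ds M) (λ v → passesOut ds (p t v) (st t v))
    passes-stable [] M t₀ p st rule s-stable s-proper p-stable p-partial _ t t≥ = p-partial t (≤-trans (m≤m+n t₀ 0) t≥)
    passes-stable (d ∷ ds) M t₀ p st rule s-stable s-proper p-stable p-partial (enough , feasible) t t≥ =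
      passes-stable ds _ t₁ p′ (λ t v → proj₂ (st t v)) rule″
        (Stable-≤ G t₀≤t₁ s-stable) (λ t t₁≤t → s-proper t (≤-trans t₀≤t₁ t₁≤t))
        (proj₁ first) (proj₂ first) feasible t (≤-trans (≤-reflexive (+-assoc t₀ _ (duration ds))) t≥)
      where
      t₁ : ℕ
      t₁ = t₀ + (2 ^ τ + (2 ^ suc τ + 2 ^ suc τ))
      t₀≤t₁ : t₀ ≤ t₁
      t₀≤t₁ = m≤m+n t₀ _
      p′ : Signal G
      p′ t v = outcome (proj₁ (st t v))
      first = pass-stable d M t₀ p (λ t v → proj₁ (st t v)) (λ t v → cong proj₁ (rule t v)) s-stable s-proper p-stable p-partial enough
      rule″ : ∀ t v → proj₂ (st (suc t) v) ≡ passesRule ds (s (suc t) v) (p′ (suc t) v)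
        (λ i → s t (nbr G v i)) (λ i → p′ t (nbr G v i)) (λ i → proj₂ (st t (nbr G v i)))
      rule″ t v rewrite rule t v = refl

-- Messages and RAM

-- Decoding is total, since the adversary may leave arbitrary bits; the round trip is promised for
-- `Valid` values only. The remainder returned by `decode` makes codecs compose.
record Codec (A : Set) : Set₁ where
  field
    width         : ℕ
    Valid         : A → Set
    encode        : A → Bits
    decode        : Bits → A × Bits
    length-encode : ∀ a → length (encode a) ≡ width
    decode-encode : ∀ a rest → Valid a → decode (encode a ++ rest) ≡ (a , rest)
open Codec

odd : ℕ → Bool
odd zero          = false
odd (suc zero)    = true
odd (suc (suc m)) = odd m

odd-half : ∀ m → χ (odd m) + 2 * ⌊ m /2⌋ ≡ m
odd-half zero          = refl
odd-half (suc zero)    = refl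
odd-half (suc (suc m)) = trans (lemma (χ (odd m)) ⌊ m /2⌋) (cong (λ k → suc (suc k)) (odd-half m))
  where
  lemma : ∀ a h → a + 2 * suc h ≡ 2 + (a + 2 * h)
  lemma a h = solve (a ∷ h ∷ [])

half-≤ : ∀ m → 2 * ⌊ m /2⌋ ≤ m
half-≤ m = ≤-trans (m≤n+m _ (χ (odd m))) (≤-reflexive (odd-half m))

encodeℕ : ℕ → ℕ → Bits
encodeℕ zero    a = []
encodeℕ (suc w) a = odd a ∷ encodeℕ w ⌊ a /2⌋

decodeℕ : ℕ → Bits → ℕ × Bits
decodeℕ zero    bs       = 0 , bs
decodeℕ (suc w) []       = 0 , []
decodeℕ (suc w) (b ∷ bs) = let a , rest = decodeℕ w bs in χ b + 2 * a , rest

length-encodeℕ : ∀ w a → length (encodeℕ w a) ≡ w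
length-encodeℕ zero    a = refl
length-encodeℕ (suc w) a = cong suc (length-encodeℕ w ⌊ a /2⌋)

decode-encodeℕ : ∀ w a rest → a < 2 ^ w → decodeℕ w (encodeℕ w a ++ rest) ≡ (a , rest)
decode-encodeℕ zero    zero rest _ = refl
decode-encodeℕ zero    (suc a) rest (s≤s ())
decode-encodeℕ (suc w) a rest a<
  rewrite decode-encodeℕ w ⌊ a /2⌋ rest (*-cancelˡ-< 2 ⌊ a /2⌋ (2 ^ w) (≤-<-trans (half-≤ a) a<)) = cong (_, rest) (odd-half a)

natCodec : ℕ → Codec ℕ
natCodec w = record
  { width = w ; Valid = _< 2 ^ w ; encode = encodeℕ w ; decode = decodeℕ w
  ; length-encode = length-encodeℕ w ; decode-encode = decode-encodeℕ w }

unitCodec : Codec ⊤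
unitCodec = record
  { width = 0 ; Valid = λ _ → ⊤ ; encode = λ _ → [] ; decode = λ bs → tt , bs
  ; length-encode = λ _ → refl ; decode-encode = λ _ _ _ → refl }

infixr 4 _×ᶜ_

_×ᶜ_ : Codec A → Codec B → Codec (A × B)
C ×ᶜ D = record
  { width  = width C + width D
  ; Valid  = λ (a , b) → Valid C a × Valid D b
  ; encode = λ (a , b) → encode C a ++ encode D b
  ; decode = λ bs → let a , bs′ = decode C bs ; b , rest = decode D bs′ in (a , b) , rest
  ; length-encode = λ (a , b) → trans (length-++ (encode C a)) (cong₂ _+_ (length-encode C a) (length-encode D b))
  ; decode-encode = λ (a , b) rest (va , vb) → roundtrip a b rest va vb
  }
  where
  roundtrip : ∀ a b rest → Valid C a → Valid D b →
    (let a′ , bs′ = decode C ((encode C a ++ encode D b) ++ rest) ; b′ , rest′ = decode D bs′ in (a′ , b′) , rest′) ≡ ((a , b) , rest)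
  roundtrip a b rest va vb
    rewrite ++-assoc (encode C a) (encode D b) rest | decode-encode C a (encode D b ++ rest) va | decode-encode D b rest vb = refl

-- The RAM holds the colour in unary, so that it can be read off without knowing n and Δ, followed by the message.
frame : ℕ → Bits → Bits
frame c m = replicate c true ++ false ∷ m

header : Bits → ℕ
header []           = 0
header (true ∷ bs)  = suc (header bs)
header (false ∷ bs) = 0

body : Bits → Bits
body []           = []
body (true ∷ bs)  = body bs
body (false ∷ bs) = bs

header-frame : ∀ c m → header (frame c m) ≡ c
header-frame zero    m = refl
header-frame (suc c) m = cong suc (header-frame c m)

body-frame : ∀ c m → body (frame c m) ≡ m
body-frame zero    m = refl
body-frame (suc c) m = body-frame c m

-- The combined protocol and its execution.

record Parameters : Set where
  field
    τ ρ α b₀ L : ℕ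
    stage      : ℕ → ℕ
    ds         : List ℕ

module Protocol (Δ : ℕ) (params : Parameters) where
  open Parameters params
  open Passes Δ τ ρ α

  State : Set
  State = ℕ × LinState L × PassesState ds

  seedOf : ℕ → LinState L → ℕ
  seedOf = linOut L

  rule : ∀ {δ} → ℕ → (Fin δ → State) → State
  -- With `suc Δ` every vertex enters the first pass uncoloured.
  rule id us = id , lin , passesRule ds (seedOf id lin) (suc Δ)
      (λ i → seedOf (proj₁ (us i)) (proj₁ (proj₂ (us i)))) (λ _ → suc Δ) (λ i → proj₂ (proj₂ (us i)))
    where lin = linRule stage L b₀ id (λ i → proj₁ (us i)) (λ i → proj₁ (proj₂ (us i)))

  colour : State → ℕ
  colour (_ , _ , r) = passesOut ds (suc Δ) r

  linCodec : ∀ L → ℕ → Codec (LinState L)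
  linCodec zero    b = unitCodec
  linCodec (suc L) b = natCodec (next stage b) ×ᶜ linCodec L (next stage b)

  -- The widths leave room for the failure values of the three searches, `2 ^ τ`, `2 ^ (2 + ρ)` and
  -- `suc Δ`.
  passCodec : Codec PassState
  passCodec = natCodec (suc τ) ×ᶜ natCodec (3 + ρ) ×ᶜ natCodec (2 + (ρ + ρ))

  passesCodec : ∀ ds → Codec (PassesState ds)
  passesCodec []       = unitCodec
  passesCodec (d ∷ ds) = passCodec ×ᶜ passesCodec ds

  stateCodec : Codec State
  stateCodec = natCodec b₀ ×ᶜ linCodec L b₀ ×ᶜ passesCodec ds

  linRule-valid : ∀ {δ} L b s (S : Fin δ → ℕ) R → Valid (linCodec L b) (linRule stage L b s S R)
  linRule-valid zero    b s S R = tt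
  linRule-valid (suc L) b s S R = linStep-< (stage b) s S , linRule-valid L _ _ (proj₁ ∘ R) (proj₂ ∘ R)

  module _ (palette : Δ < 2 ^ ρ * 2 ^ suc ρ) where

    colour-< : ∀ {c} → c ≤ suc Δ → c < 2 ^ (2 + (ρ + ρ))
    colour-< {c} c≤ = begin-strict
      c                       ≤⟨ c≤ ⟩
      suc Δ                   ≤⟨ palette ⟩
      2 ^ ρ * 2 ^ suc ρ       ≡⟨ ^-distribˡ-+-* 2 ρ (suc ρ) ⟨
      2 ^ (ρ + suc ρ)         ≡⟨ cong (2 ^_) (+-suc ρ ρ) ⟩
      2 ^ suc (ρ + ρ)         <⟨ ^-monoʳ-< 2 (s<s z<s) (n<1+n (suc (ρ + ρ))) ⟩
      2 ^ (2 + (ρ + ρ))       ∎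
      where open ≤-Reasoning

    passRule-valid : ∀ {δ} d s p (us : Fin δ → Report) → Valid passCodec (passRule d s p us)
    passRule-valid d s p us =
      ≤-<-trans (search-≤ (2 ^ τ) _) (^-monoʳ-< 2 (s<s z<s) (n<1+n τ)) ,
      PassCorrect.offset-< Δ τ ρ d α (search-≤ (2 * 2 ^ suc ρ) _) ,
      colour-< (Pass.currentRule-≤ Δ τ ρ d α _ s p _ _ us)

    passesRule-valid : ∀ {δ} ds s p (S P : Fin δ → ℕ) R → Valid (passesCodec ds) (passesRule ds s p S P R)
    passesRule-valid []       s p S P R = tt
    passesRule-valid (d ∷ ds) s p S P R =
      passRule-valid d s p (λ i → toReport (S i) (P i) (proj₁ (R i))) ,
      passesRule-valid ds s _ S (outcome ∘ proj₁ ∘ R) (proj₂ ∘ R)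

    rule-valid : ∀ {δ} id (us : Fin δ → State) → id < 2 ^ b₀ → Valid stateCodec (rule id us)
    rule-valid id us id< = id< , linRule-valid L b₀ id _ _ , passesRule-valid ds _ (suc Δ) _ _ _

  module _ {n : ℕ} (G : PortGraph n)
    (deg≤Δ    : ∀ v → deg G v ≤ Δ)
    (palette  : Δ < 2 ^ ρ * 2 ^ suc ρ)
    (ids      : n ≤ 2 ^ b₀)
    (few      : ∀ b v → deg G v * capacity b (stage b) < 2 ^ stage b)
    (capτ     : capacity (iterate L (next stage) b₀) τ ≤ α)
    (capρ     : capacity (iterate L (next stage) b₀) ρ ≤ α)
    (feasible : Feasible ds (suc Δ))
    (complete : residue ds (suc Δ) ≡ 0)
    (state    : ℕ → Fin n → State)
    (obeys    : ∀ t v → state (suc t) v ≡ rule (toℕ v) (λ i → state t (nbr G v i)))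
    where

    -- One round restores the identifiers from the ROM, `L` rounds settle Linial's levels, and the
    -- passes follow.
    protocol-correct : ∀ t → 1 + L + duration ds ≤ t → IsProperColoring G Δ (λ v → colour (state t v))
    protocol-correct t t≥ = low , λ { u v (i , refl) → proper final u i (low u) }
      where
      ident : Signal G
      ident t v = proj₁ (state t v)
      lin : ℕ → Fin n → LinState L
      lin t v = proj₁ (proj₂ (state t v))
      seeds : Signal G
      seeds t v = seedOf (ident t v) (lin t v)
      ident-rule : ∀ t v → ident (suc t) v ≡ toℕ v
      ident-rule t v = cong proj₁ (obeys t v)
      ident-stable : Stable G 1 ident
      ident-stable (suc t) v _ = trans (ident-rule (suc t) v) (sym (ident-rule t v))
      ident-proper : ∀ t → 1 ≤ t → Proper G b₀ (ident t)
      ident-proper (suc t) _ = record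
        { bounded  = λ v → subst (_< 2 ^ b₀) (sym (ident-rule t v)) (<-≤-trans (toℕ<n v) ids)
        ; distinct = λ v i e → nbr-irrefl G v i (sym (toℕ-injective (trans (sym (ident-rule t v)) (trans e (ident-rule t (nbr G v i)))))) }
      lin-rule : ∀ t v → lin (suc t) v ≡ linRule stage L b₀ (ident (suc t) v) (λ i → ident t (nbr G v i)) (λ i → lin t (nbr G v i))
      lin-rule t v rewrite obeys t v = refl
      seeds-good : Stable G (1 + L) seeds × (∀ t → 1 + L ≤ t → Proper G (iterate L (next stage) b₀) (seeds t))
      seeds-good = lin-stable G stage few L b₀ 1 ident lin lin-rule ident-stable ident-proper
      passes-rule : ∀ t v → proj₂ (proj₂ (state (suc t) v)) ≡ passesRule ds (seeds (suc t) v) (suc Δ)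
        (λ i → seeds t (nbr G v i)) (λ _ → suc Δ) (λ i → proj₂ (proj₂ (state t (nbr G v i))))
      passes-rule t v rewrite obeys t v = refl
      blank : ∀ t → 1 + L ≤ t → Partial G Δ (suc Δ) (λ _ → suc Δ)
      blank t _ = record
        { proper = λ v i Δ< → contradiction Δ< 1+n≰n
        ; sparse = λ v _ → s≤s (≤-trans (∑-mono (allFin (deg G v)) λ i → χ-≤1 (Δ <ᵇ suc Δ))
            (≤-trans (≤-reflexive (trans (∑-const (allFin (deg G v)) 1) (trans (*-identityʳ _) (length-allFin (deg G v))))) (deg≤Δ v))) }
      final : Partial G Δ 0 (λ v → colour (state t v))
      final = subst (λ M → Partial G Δ M (λ v → colour (state t v))) complete
        (passes-stable G (iterate L (next stage) b₀) deg≤Δ capτ capρ palette seeds ds (suc Δ) (1 + L) (λ _ _ → suc Δ)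
          (λ t v → proj₂ (proj₂ (state t v))) passes-rule (proj₁ seeds-good) (proj₂ seeds-good)
          (λ _ _ _ → refl) blank feasible t t≥)
      low : ∀ v → colour (state t v) ≤ Δ
      low v = ≮⇒≥ λ Δ<c → contradiction (sparse final v Δ<c) λ ()

module Machine (parameters : ℕ → ℕ → Parameters) where

  algorithm : Algorithm
  algorithm = record
    -- Truncation keeps the message short even when the adversary has left an overlong RAM; records
    -- written by `update` have exactly this width.
    { send   = λ id n Δ d ram i → take (width (codec n Δ)) (body ram)
    ; update = λ id n Δ d ram msg → let open Protocol Δ (parameters n Δ)
                                        state = rule id (λ i → proj₁ (decode stateCodec (msg i)))
                                    in frame (colour state) (encode stateCodec state)
    ; color  = header
    }
    where
    codec : ∀ n Δ → Codec _
    codec n Δ = Protocol.stateCodec Δ (parameters n Δ)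

  module _ {n : ℕ} (G : PortGraph n) (Δ : ℕ) where
    open Parameters (parameters n Δ)
    open Protocol Δ (parameters n Δ)

    message-length : ∀ cfg v i → length (outMsg algorithm G Δ cfg v i) ≤ width stateCodec
    message-length cfg v i = ≤-trans (≤-reflexive (length-take (width stateCodec) (body (cfg v)))) (m⊓n≤m _ _)

    -- Read through the same truncation as by a neighbour, so adversarial RAM has a definite state
    -- too and the rule holds from the first round on.
    state : Config n → ℕ → Fin n → State
    state cfg t v = proj₁ (decode stateCodec (take (width stateCodec) (body (run algorithm G Δ t cfg v))))

    module _ (palette : Δ < 2 ^ ρ * 2 ^ suc ρ) (ids : n ≤ 2 ^ b₀) (cfg : Config n) where

      state-obeys : ∀ t v → state cfg (suc t) v ≡ rule (toℕ v) (λ i → state cfg t (nbr G v i))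
      state-obeys t v
        rewrite body-frame (colour (rule (toℕ v) (λ i → state cfg t (nbr G v i)))) (encode stateCodec (rule (toℕ v) (λ i → state cfg t (nbr G v i))))
              | take-all (width stateCodec) (encode stateCodec (rule (toℕ v) (λ i → state cfg t (nbr G v i)))) (≤-reflexive (length-encode stateCodec _))
        = cong proj₁ (trans (cong (decode stateCodec) (sym (++-identityʳ _)))
            (decode-encode stateCodec _ [] (rule-valid palette (toℕ v) _ (<-≤-trans (toℕ<n v) ids))))

      color-state : ∀ t v → color algorithm (run algorithm G Δ (suc t) cfg v) ≡ colour (state cfg (suc t) v)
      color-state t v = trans (header-frame (colour (rule (toℕ v) (λ i → state cfg t (nbr G v i)))) _) (cong colour (sym (state-obeys t v)))

-- Choice of the parameters

≤-slack : ∀ {a b} k → b ≡ a + k → a ≤ b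
≤-slack {a} k e = ≤-trans (m≤m+n a k) (≤-reflexive (sym e))

1+n≤2^n : ∀ n → suc n ≤ 2 ^ n
1+n≤2^n zero    = ≤-refl
1+n≤2^n (suc n) = begin
  suc (suc n)         ≤⟨ ≤-slack n (lemma n) ⟩
  2 * suc n           ≤⟨ *-monoʳ-≤ 2 (1+n≤2^n n) ⟩
  2 * 2 ^ n           ∎
  where
  open ≤-Reasoning
  lemma : ∀ n → 2 * suc n ≡ suc (suc n) + n
  lemma n = solve (n ∷ [])

⌈log₂⌉-≤ : ∀ m k → m ≤ 2 ^ k → ⌈log₂ m ⌉ ≤ k
⌈log₂⌉-≤ m k m≤ = ≤-trans (⌈log₂⌉-mono-≤ m≤) (≤-reflexive (⌈log₂2^n⌉≡n k))

n≤2*⌈n/2⌉ : ∀ n → n ≤ 2 * ⌈ n /2⌉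
n≤2*⌈n/2⌉ n = begin
  n                       ≡⟨ ⌊n/2⌋+⌈n/2⌉≡n n ⟨
  ⌊ n /2⌋ + ⌈ n /2⌉       ≤⟨ +-monoˡ-≤ ⌈ n /2⌉ (⌊n/2⌋≤⌈n/2⌉ n) ⟩
  ⌈ n /2⌉ + ⌈ n /2⌉       ≡⟨ cong (⌈ n /2⌉ +_) (+-identityʳ _) ⟨
  2 * ⌈ n /2⌉             ∎
  where open ≤-Reasoning

n≤2^⌈log₂n⌉ : ∀ n → n ≤ 2 ^ ⌈log₂ n ⌉
n≤2^⌈log₂n⌉ = <-rec (λ n → n ≤ 2 ^ ⌈log₂ n ⌉) go
  where
  open ≤-Reasoning
  go : ∀ n → (∀ {m} → m < n → m ≤ 2 ^ ⌈log₂ m ⌉) → n ≤ 2 ^ ⌈log₂ n ⌉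
  go zero          IH = z≤n
  go (suc zero)    IH = 0<2^ ⌈log₂ 1 ⌉
  go n@(suc (suc m)) IH = begin
    n                                 ≤⟨ n≤2*⌈n/2⌉ n ⟩
    2 * ⌈ n /2⌉                       ≤⟨ *-monoʳ-≤ 2 (IH (⌈n/2⌉<n m)) ⟩
    2 ^ suc ⌈log₂ ⌈ n /2⌉ ⌉           ≡⟨ cong (λ k → 2 ^ suc k) (⌈log₂⌈n/2⌉⌉≡⌈log₂n⌉∸1 n) ⟩
    2 ^ suc (⌈log₂ n ⌉ ∸ 1)           ≡⟨ cong (2 ^_) (m+[n∸m]≡n (⌈log₂⌉-mono-≤ {2} {n} (s≤s (s≤s z≤n)))) ⟩
    2 ^ ⌈log₂ n ⌉                     ∎

2^⌈log₂n⌉≤2n : ∀ n → 0 < n → 2 ^ ⌈log₂ n ⌉ ≤ 2 * n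
2^⌈log₂n⌉≤2n n 0<n with ⌈log₂ n ⌉ in e
... | zero  = ≤-trans 0<n (m≤m+n n _)
... | suc k = *-monoʳ-≤ 2 (<⇒≤ (≰⇒> λ n≤ → 1+n≰n (≤-trans (≤-reflexive (sym e)) (⌈log₂⌉-≤ n k n≤))))

n<2^1+⌊log₂n⌋ : ∀ n → n < 2 ^ suc ⌊log₂ n ⌋
n<2^1+⌊log₂n⌋ n = ≰⇒> λ 2^≤n → 1+n≰n (≤-trans (≤-reflexive (sym (⌊log₂[2^n]⌋≡n _))) (⌊log₂⌋-mono-≤ 2^≤n))

-- With q the quotient of m by 2^j, m ≤ (q + 1) 2^j ≤ 2^(q + j). This replaces a logarithm by a
-- linear function of slope 1/2^j.
⌈log₂⌉-linear : ∀ j m → 2 ^ j * ⌈log₂ m ⌉ ≤ m + 2 ^ j * j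
⌈log₂⌉-linear j m = begin
  2 ^ j * ⌈log₂ m ⌉            ≤⟨ *-monoʳ-≤ (2 ^ j) (⌈log₂⌉-≤ m (j + q) m≤) ⟩
  2 ^ j * (j + q)              ≡⟨ lemma (2 ^ j) j q ⟩
  q * 2 ^ j + 2 ^ j * j        ≤⟨ +-monoˡ-≤ (2 ^ j * j) (≤-trans (m≤n+m _ (m % 2 ^ j)) (≤-reflexive (sym (m≡m%n+[m/n]*n m (2 ^ j))))) ⟩
  m + 2 ^ j * j                ∎
  where
  open ≤-Reasoning
  instance
    2^j≢0 : NonZero (2 ^ j)
    2^j≢0 = m^n≢0 2 j
  q = m / 2 ^ j
  lemma : ∀ p j q → p * (j + q) ≡ q * p + p * j
  lemma p j q = solve (p ∷ j ∷ q ∷ [])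
  m≤ : m ≤ 2 ^ (j + q)
  m≤ = begin
    m                                ≡⟨ m≡m%n+[m/n]*n m (2 ^ j) ⟩
    m % 2 ^ j + q * 2 ^ j            ≤⟨ +-monoˡ-≤ (q * 2 ^ j) (<⇒≤ (m%n<n m (2 ^ j))) ⟩
    suc q * 2 ^ j                    ≤⟨ *-monoˡ-≤ (2 ^ j) (1+n≤2^n q) ⟩
    2 ^ q * 2 ^ j                    ≡⟨ *-comm (2 ^ q) (2 ^ j) ⟩
    2 ^ j * 2 ^ q                    ≡⟨ ^-distribˡ-+-* 2 j q ⟨
    2 ^ (j + q)                      ∎

-- Here 2 ^ e is of the order of Δ^(1/4), and colours are measured by their number b of bits.
module Schedule (e : ℕ) where

  excess : ℕ → ℕ
  excess b = ⌈log₂ (b + e + 1) ⌉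

  -- `2 ^ (4 * e)` bounds the degree, and `2 ^ (excess b + 6)` exceeds the capacity, which grows at
  -- most linearly in `b + e`.
  stageOf : ℕ → ℕ
  stageOf b = 4 * e + (excess b + 6)

  threshold : ℕ
  threshold = 60 * (e + 1)

  -- Stopping below the threshold keeps the total length of all levels at most twice the first (next-halves).
  levels : ℕ → ℕ → ℕ
  levels n b₀ = search (logStar n) λ i → iterate i (next stageOf) b₀ ≤ᵇ threshold

  next≡ : ∀ b → next stageOf b ≡ 8 * e + 2 * excess b + 14
  next≡ b = lemma e (excess b)
    where
    lemma : ∀ e h → 2 + ((4 * e + (h + 6)) + (4 * e + (h + 6))) ≡ 8 * e + 2 * h + 14
    lemma e h = solve (e ∷ h ∷ [])

  excess-≤ : ∀ b → excess b ≤ b + e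
  excess-≤ b = ⌈log₂⌉-≤ (b + e + 1) (b + e) (≤-trans (≤-reflexive (+-comm (b + e) 1)) (1+n≤2^n (b + e)))

  stage-capacity : ∀ b → capacity b (stageOf b) < 2 ^ (excess b + 6)
  stage-capacity b = begin-strict
    capacity b (stageOf b)                         ≡⟨ expand b e (excess b) ⟩
    b + 8 * e + 2 * excess b + 19                  ≤⟨ +-monoˡ-≤ 19 (+-monoʳ-≤ (b + 8 * e) (*-monoʳ-≤ 2 (excess-≤ b))) ⟩
    b + 8 * e + 2 * (b + e) + 19                   <⟨ ≤-slack (61 * b + 54 * e + 44) (slack b e) ⟩
    (b + e + 1) * 64                               ≤⟨ *-monoˡ-≤ 64 (n≤2^⌈log₂n⌉ (b + e + 1)) ⟩
    2 ^ excess b * 2 ^ 6                           ≡⟨ ^-distribˡ-+-* 2 (excess b) 6 ⟨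
    2 ^ (excess b + 6)                             ∎
    where
    open ≤-Reasoning
    expand : ∀ b e h → suc (b + ((3 + (4 * e + (h + 6))) + (3 + (4 * e + (h + 6))))) ≡ b + 8 * e + 2 * h + 19
    expand b e h = solve (b ∷ e ∷ h ∷ [])
    slack : ∀ b e → (b + e + 1) * 64 ≡ suc (b + 8 * e + 2 * (b + e) + 19) + (61 * b + 54 * e + 44)
    slack b e = solve (b ∷ e ∷ [])

  stage-few : ∀ {d} b → d ≤ 2 ^ (4 * e) → d * capacity b (stageOf b) < 2 ^ stageOf b
  stage-few {d} b d≤ = begin-strict
    d * capacity b (stageOf b)                     ≤⟨ *-monoˡ-≤ (capacity b (stageOf b)) d≤ ⟩
    2 ^ (4 * e) * capacity b (stageOf b)           <⟨ *-monoʳ-< (2 ^ (4 * e)) {{m^n≢0 2 (4 * e)}} (stage-capacity b) ⟩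
    2 ^ (4 * e) * 2 ^ (excess b + 6)               ≡⟨ ^-distribˡ-+-* 2 (4 * e) (excess b + 6) ⟨
    2 ^ stageOf b                                  ∎
    where open ≤-Reasoning

  next-halves : ∀ {b} → threshold < b → 2 * next stageOf b ≤ b
  next-halves {b} big = *-cancelˡ-≤ 4 (begin
    4 * (2 * next stageOf b)                       ≡⟨ cong (λ x → 4 * (2 * x)) (next≡ b) ⟩
    4 * (2 * (8 * e + 2 * excess b + 14))          ≡⟨ expand e (excess b) ⟩
    -- The multiplication by 4 has brought the coefficient of `excess b` to `2 ^ 4`, as
    -- `⌈log₂⌉-linear 4` requires.
    64 * e + 112 + 16 * excess b                   ≤⟨ +-monoʳ-≤ (64 * e + 112) (⌈log₂⌉-linear 4 (b + e + 1)) ⟩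
    64 * e + 112 + (b + e + 1 + 64)                ≤⟨ ≤-slack (115 * e + 3) (slack b e) ⟩
    3 * (60 * (e + 1)) + b                         ≤⟨ +-monoˡ-≤ b (*-monoʳ-≤ 3 (<⇒≤ big)) ⟩
    3 * b + b                                      ≡⟨ collect b ⟩
    4 * b                                          ∎)
    where
    open ≤-Reasoning
    expand : ∀ e h → 4 * (2 * (8 * e + 2 * h + 14)) ≡ 64 * e + 112 + 16 * h
    expand e h = solve (e ∷ h ∷ [])
    slack : ∀ b e → 3 * (60 * (e + 1)) + b ≡ 64 * e + 112 + (b + e + 1 + 64) + (115 * e + 3)
    slack b e = solve (b ∷ e ∷ [])
    collect : ∀ b → 3 * b + b ≡ 4 * b
    collect b = solve (b ∷ [])

  -- One level of the reduction keeps pace with one logarithm, hence logStar n levels suffice, with coefficient one.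
  next-tower : ∀ {b} m → b ≤ 30 * (e + 1) + 2 * m → next stageOf b ≤ 30 * (e + 1) + 2 * ⌊log₂ m ⌋
  next-tower {b} m b≤ = begin
    next stageOf b                                 ≡⟨ next≡ b ⟩
    8 * e + 2 * excess b + 14                      ≤⟨ +-monoˡ-≤ 14 (+-monoʳ-≤ (8 * e) (*-monoʳ-≤ 2 (⌈log₂⌉-≤ (b + e + 1) (6 + (e + suc f)) fits))) ⟩
    8 * e + 2 * (6 + (e + suc f)) + 14             ≤⟨ ≤-slack (20 * e + 2) (slack e f) ⟩
    30 * (e + 1) + 2 * f                           ∎
    where
    open ≤-Reasoning
    f = ⌊log₂ m ⌋
    slack : ∀ e f → 30 * (e + 1) + 2 * f ≡ 8 * e + 2 * (6 + (e + suc f)) + 14 + (20 * e + 2)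
    slack e f = solve (e ∷ f ∷ [])
    regroup : ∀ e m → 30 * (e + 1) + 2 * m + e + 1 ≡ 31 * suc e + 2 * m
    regroup e m = solve (e ∷ m ∷ [])
    expand : ∀ e m → 64 * (suc e * suc m) ≡ 31 * suc e + 2 * m + (33 * e + 33 + 62 * m + 64 * (e * m))
    expand e m = solve (e ∷ m ∷ [])
    fits : b + e + 1 ≤ 2 ^ (6 + (e + suc f))
    fits = begin
      b + e + 1                                    ≤⟨ +-monoˡ-≤ 1 (+-monoˡ-≤ e b≤) ⟩
      30 * (e + 1) + 2 * m + e + 1                 ≡⟨ regroup e m ⟩
      31 * suc e + 2 * m                           ≤⟨ ≤-slack _ (expand e m) ⟩
      64 * (suc e * suc m)                         ≤⟨ *-monoʳ-≤ 64 (*-mono-≤ (1+n≤2^n e) (n<2^1+⌊log₂n⌋ m)) ⟩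
      2 ^ 6 * (2 ^ e * 2 ^ suc f)                  ≡⟨ cong (2 ^ 6 *_) (^-distribˡ-+-* 2 e (suc f)) ⟨
      2 ^ 6 * 2 ^ (e + suc f)                      ≡⟨ ^-distribˡ-+-* 2 6 (e + suc f) ⟨
      2 ^ (6 + (e + suc f))                        ∎

  tower-bottom : ∀ {b} m → m ≤ 1 → b ≤ 30 * (e + 1) + 2 * m → b ≤ threshold
  tower-bottom {b} m m≤1 b≤ = begin
    b                          ≤⟨ b≤ ⟩
    30 * (e + 1) + 2 * m       ≤⟨ +-monoʳ-≤ (30 * (e + 1)) (*-monoʳ-≤ 2 m≤1) ⟩
    30 * (e + 1) + 2           ≤⟨ ≤-slack (30 * e + 28) (slack e) ⟩
    threshold                  ∎
    where
    open ≤-Reasoning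
    slack : ∀ e → 60 * (e + 1) ≡ 30 * (e + 1) + 2 + (30 * e + 28)
    slack e = solve (e ∷ [])

  -- The invariant `m ≤ f` keeps the fuel of `logStar′` from running out while `m` exceeds 1.
  tower : ∀ f m b → m ≤ f → b ≤ 30 * (e + 1) + 2 * m → iterate (logStar′ f m) (next stageOf) b ≤ threshold
  tower zero    m b m≤f b≤ = tower-bottom m (≤-trans m≤f z≤n) b≤
  tower (suc f) m b m≤f b≤ with m ≤? 1
  ... | yes m≤1 = tower-bottom m m≤1 b≤
  ... | no  m≰1 = tower f ⌊log₂ m ⌋ (next stageOf b) (shrink m m≤f (≰⇒> m≰1)) (next-tower m b≤)
    where
    shrink : ∀ m → m ≤ suc f → 1 < m → ⌊log₂ m ⌋ ≤ f
    shrink (suc m) (s≤s m≤f) _ = ≤-trans (⌊log₂⌋-mono-≤ (1+n≤2^n m)) (≤-trans (≤-reflexive (⌊log₂[2^n]⌋≡n m)) m≤f)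

  levels-reach : ∀ n → iterate (levels n ⌈log₂ n ⌉) (next stageOf) ⌈log₂ n ⌉ ≤ threshold
  levels-reach n with searched (logStar n) (λ i → iterate i (next stageOf) ⌈log₂ n ⌉ ≤ᵇ threshold)
  ... | found _ reached _ = ≤ᵇ-true⁻ reached
  ... | absent L≡ _ rewrite L≡ = tower n n ⌈log₂ n ⌉ ≤-refl start
    where
    start : ⌈log₂ n ⌉ ≤ 30 * (e + 1) + 2 * n
    start = ≤-trans (⌈log₂⌉-≤ n n (≤-trans (n≤1+n n) (1+n≤2^n n))) (≤-trans (m≤m+n n (n + 0)) (m≤n+m (2 * n) (30 * (e + 1))))

  levels-above : ∀ n b₀ {i} → i < levels n b₀ → threshold < iterate i (next stageOf) b₀
  levels-above n b₀ i< with searched (logStar n) (λ i → iterate i (next stageOf) b₀ ≤ᵇ threshold)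
  ... | found _ _ before = ≤ᵇ-false⁻ (before i<)
  ... | absent L≡ none   = ≤ᵇ-false⁻ (none (<-≤-trans i< (≤-reflexive L≡)))

2^+ : ∀ m n → 2 ^ m * 2 ^ n ≡ 2 ^ (m + n)
2^+ m n = sym (^-distribˡ-+-* 2 m n)

module PassSchedule (e : ℕ) where
  open Schedule e

  -- The 8 in `κ` absorbs the constants of `capacity-τ`; the 24 in `τ` is what the condition of the
  -- third pass demands. The palette becomes a grid with sides of order √Δ.
  h κ τ ρ : ℕ
  h = ⌈log₂ (e + 1) ⌉
  κ = h + 8
  τ = (3 * e + κ) + 24
  ρ = 2 * e

  -- 2 ^ κ = O(log Δ) bounds all agreements, and the stages of the three passes are all chosen of the same order
  -- Δ^(3/4) log Δ.
  defects : List ℕ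
  defects = 2 ^ e ∷ 2 ^ κ ∷ 0 ∷ []

  open module P (Δ : ℕ) = Passes Δ τ ρ (2 ^ κ) using (Feasible; residue; duration) public

  h≤e : h ≤ e
  h≤e = ⌈log₂⌉-≤ (e + 1) e (≤-trans (≤-reflexive (+-comm e 1)) (1+n≤2^n e))

  -- For the third pass: its condition contains `κ` three times, but `τ` only once, and the surplus
  -- `2 * h` is paid from `e`.
  2h≤e+5 : 2 * h ≤ e + 5
  2h≤e+5 = *-cancelˡ-≤ 2 (begin
    2 * (2 * h)      ≡⟨ *-assoc 2 2 h ⟨
    4 * h            ≤⟨ ⌈log₂⌉-linear 2 (e + 1) ⟩
    e + 1 + 8        ≤⟨ ≤-slack (e + 1) (slack e) ⟩
    2 * (e + 5)      ∎)
    where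
    open ≤-Reasoning
    slack : ∀ e → 2 * (e + 5) ≡ e + 1 + 8 + (e + 1)
    slack e = solve (e ∷ [])

  capacity-τ : ∀ {b} → b ≤ threshold → capacity b τ ≤ 2 ^ κ
  capacity-τ {b} b≤ = begin
    capacity b τ                             ≡⟨ expand b e h ⟩
    b + 6 * e + 2 * h + 71                   ≤⟨ +-monoˡ-≤ 71 (+-mono-≤ (+-monoˡ-≤ (6 * e) b≤) (*-monoʳ-≤ 2 h≤e)) ⟩
    60 * (e + 1) + 6 * e + 2 * e + 71        ≤⟨ ≤-slack (188 * e + 125) (slack e) ⟩
    (e + 1) * 2 ^ 8                          ≤⟨ *-monoˡ-≤ (2 ^ 8) (n≤2^⌈log₂n⌉ (e + 1)) ⟩
    2 ^ h * 2 ^ 8                            ≡⟨ 2^+ h 8 ⟩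
    2 ^ κ                                    ∎
    where
    open ≤-Reasoning
    expand : ∀ b e h → suc (b + ((3 + ((3 * e + (h + 8)) + 24)) + (3 + ((3 * e + (h + 8)) + 24)))) ≡ b + 6 * e + 2 * h + 71
    expand b e h = solve (b ∷ e ∷ h ∷ [])
    slack : ∀ e → (e + 1) * 256 ≡ 60 * (e + 1) + 6 * e + 2 * e + 71 + (188 * e + 125)
    slack e = solve (e ∷ [])

  capacity-ρ : ∀ {b} → b ≤ threshold → capacity b ρ ≤ 2 ^ κ
  capacity-ρ {b} b≤ = ≤-trans (s≤s (+-monoʳ-≤ b (+-mono-≤ ρ≤τ ρ≤τ))) (capacity-τ b≤)
    where
    ρ≤τ : 3 + ρ ≤ 3 + τ
    ρ≤τ = +-monoʳ-≤ 3 (≤-trans (*-monoˡ-≤ e (n≤1+n 2)) (≤-trans (m≤m+n (3 * e) κ) (m≤m+n _ 24)))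

  palette : ∀ {Δ} → Δ ≤ 2 ^ (4 * e) → Δ < 2 ^ ρ * 2 ^ suc ρ
  palette {Δ} Δ≤ = begin-strict
    Δ                         ≤⟨ Δ≤ ⟩
    2 ^ (4 * e)               <⟨ ^-monoʳ-< 2 (s<s z<s) (n<1+n (4 * e)) ⟩
    2 ^ suc (4 * e)           ≡⟨ cong (2 ^_) (lemma e) ⟩
    2 ^ (ρ + suc ρ)           ≡⟨ 2^+ ρ (suc ρ) ⟨
    2 ^ ρ * 2 ^ suc ρ         ∎
    where
    open ≤-Reasoning
    lemma : ∀ e → suc (4 * e) ≡ 2 * e + suc (2 * e)
    lemma e = solve (e ∷ [])

  α+α≡ : 2 ^ κ + 2 ^ κ ≡ 2 ^ suc κ
  α+α≡ = cong (2 ^ κ +_) (sym (+-identityʳ _))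

  enough : ∀ {M m} k d → M ≤ 2 ^ m → 2 ^ k ≤ suc d → m + suc κ ≤ k + τ → M * (2 ^ κ + 2 ^ κ) ≤ suc d * 2 ^ τ
  enough {M} {m} k d M≤ d≥ m+κ≤ = begin
    M * (2 ^ κ + 2 ^ κ)       ≤⟨ *-mono-≤ M≤ (≤-reflexive α+α≡) ⟩
    2 ^ m * 2 ^ suc κ         ≡⟨ 2^+ m (suc κ) ⟩
    2 ^ (m + suc κ)           ≤⟨ 2^-mono-≤ m+κ≤ ⟩
    2 ^ (k + τ)               ≡⟨ 2^+ k τ ⟨
    2 ^ k * 2 ^ τ             ≤⟨ *-monoˡ-≤ (2 ^ τ) d≥ ⟩
    suc d * 2 ^ τ             ∎
    where open ≤-Reasoning

  remainder≡ : ∀ k → 2 * 2 ^ suc ρ * (2 ^ k * 2 ^ κ) ≡ 2 ^ (2 + ρ + (k + κ))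
  remainder≡ k = trans (cong (2 ^ (2 + ρ) *_) (2^+ k κ)) (2^+ (2 + ρ) (k + κ))

  feasible : ∀ {Δ} → Δ ≤ 2 ^ (4 * e) → Feasible Δ defects (suc Δ)
  feasible {Δ} Δ≤ =
    -- In each line `2 ^ m` bounds `M` before the pass: at first `suc Δ`, then the number of slices
    -- times `d * α` for the preceding `d`.
    enough {m = suc (4 * e)} e (2 ^ e) 1+Δ≤ (n≤1+n _) (≤-slack 22 (slack₁ e h)) ,
    enough {m = 2 + ρ + (e + κ)} κ (2 ^ κ) (≤-reflexive (remainder≡ e)) (n≤1+n _) (≤-slack 21 (slack₂ e h)) ,
    enough {m = 2 + ρ + (κ + κ)} 0 0 (≤-reflexive (remainder≡ κ)) ≤-refl last ,
    tt
    where
    open ≤-Reasoning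
    1+Δ≤ : suc Δ ≤ 2 ^ suc (4 * e)
    1+Δ≤ = ≤-<-trans Δ≤ (^-monoʳ-< 2 (s<s z<s) (n<1+n (4 * e)))
    slack₁ : ∀ e h → e + ((3 * e + (h + 8)) + 24) ≡ suc (4 * e) + suc (h + 8) + 22
    slack₁ e h = solve (e ∷ h ∷ [])
    slack₂ : ∀ e h → (h + 8) + ((3 * e + (h + 8)) + 24) ≡ 2 + 2 * e + (e + (h + 8)) + suc (h + 8) + 21
    slack₂ e h = solve (e ∷ h ∷ [])
    expand₃ : ∀ e h → 2 + 2 * e + ((h + 8) + (h + 8)) + suc (h + 8) ≡ 2 * h + (2 * e + h + 27)
    expand₃ e h = solve (e ∷ h ∷ [])
    collect₃ : ∀ e h → e + 5 + (2 * e + h + 27) ≡ (3 * e + (h + 8)) + 24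
    collect₃ e h = solve (e ∷ h ∷ [])
    last : 2 + ρ + (κ + κ) + suc κ ≤ τ
    last = begin
      2 + ρ + (κ + κ) + suc κ         ≡⟨ expand₃ e h ⟩
      2 * h + (2 * e + h + 27)        ≤⟨ +-monoˡ-≤ (2 * e + h + 27) 2h≤e+5 ⟩
      e + 5 + (2 * e + h + 27)        ≡⟨ collect₃ e h ⟩
      τ                               ∎

  complete : ∀ Δ → residue Δ defects (suc Δ) ≡ 0
  complete Δ = *-zeroʳ (2 * 2 ^ suc ρ)

  duration≡ : ∀ Δ → duration Δ defects ≡ 15 * 2 ^ τ
  duration≡ Δ = lemma (2 ^ τ)
    where
    lemma : ∀ t → t + (2 * t + 2 * t) + (t + (2 * t + 2 * t) + (t + (2 * t + 2 * t) + 0)) ≡ 15 * t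
    lemma t = solve (t ∷ [])

  stages-≤ : ∀ k → κ + 24 ≡ h + k → 2 ^ τ ≤ 2 ^ suc k * (2 ^ (3 * e) * (e + 1))
  stages-≤ k split = begin
    2 ^ τ                                       ≡⟨ cong (2 ^_) (trans (+-assoc (3 * e) κ 24) (cong (3 * e +_) split)) ⟩
    2 ^ (3 * e + (h + k))                       ≡⟨ 2^+ (3 * e) (h + k) ⟨
    2 ^ (3 * e) * 2 ^ (h + k)                   ≡⟨ cong (2 ^ (3 * e) *_) (2^+ h k) ⟨
    2 ^ (3 * e) * (2 ^ h * 2 ^ k)               ≤⟨ *-monoʳ-≤ (2 ^ (3 * e)) (*-monoˡ-≤ (2 ^ k) (2^⌈log₂n⌉≤2n (e + 1) (m≤n+m 1 e))) ⟩
    2 ^ (3 * e) * (2 * (e + 1) * 2 ^ k)         ≡⟨ lemma (2 ^ k) (2 ^ (3 * e)) (e + 1) ⟩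
    2 ^ suc k * (2 ^ (3 * e) * (e + 1))         ∎
    where
    open ≤-Reasoning
    lemma : ∀ a p q → p * (2 * q * a) ≡ 2 * a * (p * q)
    lemma a p q = solve (a ∷ p ∷ q ∷ [])

-- Opaque because conversion checking would otherwise unfold multiplications by this numeral.
opaque
  factor : ℕ
  factor = 2 ^ 33

  stages-≤-factor : ∀ e → 2 ^ PassSchedule.τ e ≤ factor * (2 ^ (3 * e) * (e + 1))
  stages-≤-factor e = PassSchedule.stages-≤ e 32 (+-assoc (PassSchedule.h e) 8 24)

-- Fourth roots and the rate Δ^(3/4) log Δ.

scale : ℕ → ℕ
scale ℓ = suc (ℓ / 4)

ℓ≤4scale : ∀ ℓ → ℓ ≤ 4 * scale ℓ
ℓ≤4scale ℓ = begin
  ℓ                       ≡⟨ m≡m%n+[m/n]*n ℓ 4 ⟩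
  ℓ % 4 + ℓ / 4 * 4       ≤⟨ +-monoˡ-≤ _ (<⇒≤ (m%n<n ℓ 4)) ⟩
  4 + ℓ / 4 * 4           ≡⟨ *-comm (scale ℓ) 4 ⟩
  4 * scale ℓ             ∎
  where open ≤-Reasoning

4scale≤ : ∀ ℓ → 4 * scale ℓ ≤ 4 + ℓ
4scale≤ ℓ = begin
  4 * scale ℓ             ≡⟨ *-comm 4 (scale ℓ) ⟩
  4 + ℓ / 4 * 4           ≤⟨ +-monoʳ-≤ 4 (≤-trans (m≤n+m _ (ℓ % 4)) (≤-reflexive (sym (m≡m%n+[m/n]*n ℓ 4)))) ⟩
  4 + ℓ                   ∎
  where open ≤-Reasoning

scale≤ : ∀ ℓ → scale ℓ ≤ suc ℓ
scale≤ ℓ = s≤s (m/n≤m ℓ 4)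

^-distribʳ-* : ∀ k m n → (m * n) ^ k ≡ m ^ k * n ^ k
^-distribʳ-* zero    m n = refl
^-distribʳ-* (suc k) m n = trans (cong (m * n *_) (^-distribʳ-* k m n)) (lemma m n (m ^ k) (n ^ k))
  where
  lemma : ∀ m n p q → m * n * (p * q) ≡ m * p * (n * q)
  lemma m n p q = solve (m ∷ n ∷ p ∷ q ∷ [])

-- Here `r` stands for a bound on Δ^(3/4), so fourth powers are compared. Passing from `k` to the
-- multiple of four above `suc k` costs at most the factor `2 ^ 4`.
scale-root : ∀ k r → 2 ^ (3 * k) ≤ r ^ 4 → 2 ^ (3 * scale (suc k)) ≤ r * 2 ^ 4
scale-root k r k≤ = ≮⇒≥ λ small → <⇒≱ (^-monoˡ-< 4 small) (begin
  (2 ^ (3 * s)) ^ 4                   ≡⟨ ^-*-assoc 2 (3 * s) 4 ⟩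
  2 ^ (3 * s * 4)                     ≤⟨ 2^-mono-≤ exponent ⟩
  2 ^ (3 * k + 4 * 4)                 ≡⟨ 2^+ (3 * k) (4 * 4) ⟨
  2 ^ (3 * k) * 2 ^ (4 * 4)           ≤⟨ *-monoˡ-≤ (2 ^ (4 * 4)) k≤ ⟩
  r ^ 4 * 2 ^ (4 * 4)                 ≡⟨ cong (r ^ 4 *_) (^-*-assoc 2 4 4) ⟨
  r ^ 4 * (2 ^ 4) ^ 4                 ≡⟨ ^-distribʳ-* 4 r (2 ^ 4) ⟨
  (r * 2 ^ 4) ^ 4                     ∎)
  where
  open ≤-Reasoning
  s = scale (suc k)
  exponent : 3 * s * 4 ≤ 3 * k + 4 * 4
  exponent = begin
    3 * s * 4                         ≡⟨ lemma s ⟩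
    3 * (4 * s)                       ≤⟨ *-monoʳ-≤ 3 (4scale≤ (suc k)) ⟩
    3 * (4 + suc k)                   ≤⟨ ≤-slack 1 (slack k) ⟩
    3 * k + 4 * 4                     ∎
    where
    lemma : ∀ s → 3 * s * 4 ≡ 3 * (4 * s)
    lemma s = solve (s ∷ [])
    slack : ∀ k → 3 * k + 16 ≡ 3 * (4 + suc k) + 1
    slack k = solve (k ∷ [])

scale-cost : ∀ ℓ r → (∀ k → ℓ ≡ suc k → 2 ^ (3 * k) ≤ r ^ 4) → 2 ^ (3 * scale ℓ) * (scale ℓ + 1) ≤ 48 * (r * ℓ + 1)
-- Without a logarithm only the summand 1 is left to pay for the cost 16.
scale-cost zero r _ = begin
  2 ^ (3 * scale 0) * (scale 0 + 1)   ≤⟨ ≤ᵇ⇒≤ 16 48 tt ⟩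
  48                                  ≤⟨ *-monoʳ-≤ 48 (m≤n+m 1 (r * 0)) ⟩
  48 * (r * 0 + 1)                    ∎
  where open ≤-Reasoning
scale-cost ℓ@(suc k) r h = begin
  2 ^ (3 * scale ℓ) * (scale ℓ + 1)   ≤⟨ *-mono-≤ (scale-root k r (h k refl)) (+-monoˡ-≤ 1 (scale≤ ℓ)) ⟩
  -- As `ℓ ≥ 1`, `ℓ + 2 ≤ 3 * ℓ`; 48 is 3 times 16.
  r * 16 * (suc ℓ + 1)                ≤⟨ ≤-slack _ (slack k r) ⟩
  48 * (r * ℓ + 1)                    ∎
  where
  open ≤-Reasoning
  slack : ∀ k r → 48 * (r * suc k + 1) ≡ r * 16 * (suc (suc k) + 1) + (32 * (r * k) + 48)
  slack k r = solve (k ∷ r ∷ [])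

log-root : ∀ Δ r → Δ ^ 3 ≤ r ^ 4 → ∀ k → ⌈log₂ Δ ⌉ ≡ suc k → 2 ^ (3 * k) ≤ r ^ 4
log-root Δ r Δ³≤r⁴ k e = begin
  2 ^ (3 * k)     ≡⟨ cong (2 ^_) (*-comm 3 k) ⟩
  2 ^ (k * 3)     ≡⟨ ^-*-assoc 2 k 3 ⟨
  (2 ^ k) ^ 3     ≤⟨ ^-monoˡ-≤ 3 (<⇒≤ (≰⇒> λ Δ≤ → 1+n≰n (≤-trans (≤-reflexive (sym e)) (⌈log₂⌉-≤ Δ k Δ≤)))) ⟩
  Δ ^ 3           ≤⟨ Δ³≤r⁴ ⟩
  r ^ 4           ∎
  where open ≤-Reasoning

maxDegree≤n : ∀ {n Δ} (G : PortGraph n) → HasMaxDegree G Δ → Δ ≤ n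
maxDegree≤n G (_ , v , refl) = injective⇒≤ (λ {i} {j} → nbr-injective G v i j)

-- The concrete algorithm and its bounds.

parameters : ℕ → ℕ → Parameters
parameters n Δ = record
  { τ = τ ; ρ = ρ ; α = 2 ^ κ ; b₀ = ⌈log₂ n ⌉ ; L = levels n ⌈log₂ n ⌉ ; stage = stageOf ; ds = defects }
  where
  open Schedule (scale ⌈log₂ Δ ⌉)
  open PassSchedule (scale ⌈log₂ Δ ⌉)

open Machine parameters

module _ (n Δ : ℕ) (Δ≤n : Δ ≤ n) where
  private
    e = scale ⌈log₂ Δ ⌉
  open Schedule e
  open PassSchedule e
  open Protocol Δ (parameters n Δ)

  -- A geometric sum: above the threshold each level is at most half as long as the one before.
  linCodec-width : ∀ L b → (∀ {i} → i < L → threshold < iterate i (next stageOf) b) → b + Codec.width (linCodec L b) ≤ 2 * b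
  linCodec-width zero    b _ = +-monoʳ-≤ b z≤n
  linCodec-width (suc L) b above = begin
    b + (next stageOf b + Codec.width (linCodec L (next stageOf b)))  ≤⟨ +-monoʳ-≤ b (linCodec-width L (next stageOf b) λ i< → above (s≤s i<)) ⟩
    b + 2 * next stageOf b                                            ≤⟨ +-monoʳ-≤ b (next-halves (above z<s)) ⟩
    b + b                                                             ≡⟨ cong (b +_) (+-identityʳ b) ⟨
    2 * b                                                             ∎
    where open ≤-Reasoning

  stateCodec-width : Codec.width stateCodec ≤ 144 * (⌈log₂ n ⌉ + 1)
  stateCodec-width = begin
    b₀ + (Codec.width (linCodec L b₀) + P)     ≡⟨ +-assoc b₀ _ P ⟨
    b₀ + Codec.width (linCodec L b₀) + P       ≤⟨ +-monoˡ-≤ P (linCodec-width L b₀ (levels-above n b₀)) ⟩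
    2 * b₀ + P                                 ≡⟨ cong (2 * b₀ +_) (expand e h) ⟩
    2 * b₀ + (27 * e + 3 * h + 114)            ≤⟨ +-monoʳ-≤ (2 * b₀) (+-monoˡ-≤ 114 (+-monoʳ-≤ (27 * e) (*-monoʳ-≤ 3 h≤e))) ⟩
    2 * b₀ + (27 * e + 3 * e + 114)            ≤⟨ +-monoʳ-≤ (2 * b₀) (+-monoˡ-≤ 114 (+-mono-≤ (*-monoʳ-≤ 27 e≤) (*-monoʳ-≤ 3 e≤))) ⟩
    2 * b₀ + (27 * suc b₀ + 3 * suc b₀ + 114)  ≤⟨ ≤-slack (112 * b₀) (slack b₀) ⟩
    144 * (b₀ + 1)                             ∎
    where
    open ≤-Reasoning
    b₀ = ⌈log₂ n ⌉
    L = levels n b₀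
    P = Codec.width (passesCodec defects)
    e≤ : e ≤ suc b₀
    e≤ = ≤-trans (scale≤ ⌈log₂ Δ ⌉) (s≤s (⌈log₂⌉-mono-≤ Δ≤n))
    expand : ∀ e h → let τ = (3 * e + (h + 8)) + 24 ; ρ = 2 * e ; w = suc τ + ((3 + ρ) + (2 + (ρ + ρ))) in
             w + (w + (w + 0)) ≡ 27 * e + 3 * h + 114
    expand e h = solve (e ∷ h ∷ [])
    slack : ∀ b → 144 * (b + 1) ≡ 2 * b + (27 * suc b + 3 * suc b + 114) + 112 * b
    slack b = solve (b ∷ [])

-- The 144 covers the message length; in the rest, 15 counts the multiples of `2 ^ τ` in the
-- duration, and 48 comes from `scale-cost`.
constant : ℕ
constant = 144 + 15 * (factor * 48)

messages : ∀ n Δ (G : PortGraph n) → HasMaxDegree G Δ → ∀ (cfg : Config n) (t : ℕ) v i →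
  length (outMsg algorithm G Δ (run algorithm G Δ t cfg) v i) ≤ constant * (⌈log₂ n ⌉ + 1)
messages n Δ G maxDeg cfg t v i = ≤-trans (message-length G Δ (run algorithm G Δ t cfg) v i) (≤-trans
  (stateCodec-width n Δ (maxDegree≤n G maxDeg)) (*-monoˡ-≤ (⌈log₂ n ⌉ + 1) (m≤m+n 144 (15 * (factor * 48)))))

enough-time : ∀ n Δ r → Δ ^ 3 ≤ r ^ 4 → let open Schedule (scale ⌈log₂ Δ ⌉) ; open PassSchedule (scale ⌈log₂ Δ ⌉) in
  1 + levels n ⌈log₂ n ⌉ + duration Δ defects ≤ constant * (r * ⌈log₂ Δ ⌉ + 1) + logStar n
enough-time n Δ r Δ³≤r⁴ = begin
  1 + levels n ⌈log₂ n ⌉ + duration Δ defects      ≤⟨ +-mono-≤ (s≤s (search-≤ (logStar n) _)) (≤-reflexive (duration≡ Δ)) ⟩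
  1 + logStar n + 15 * 2 ^ τ                       ≤⟨ +-monoʳ-≤ (1 + logStar n) (*-monoʳ-≤ 15 (≤-trans (stages-≤-factor e)
                                                        (*-monoʳ-≤ factor (scale-cost ⌈log₂ Δ ⌉ r (log-root Δ r Δ³≤r⁴))))) ⟩
  1 + logStar n + 15 * (factor * (48 * (y + 1)))   ≡⟨ cong (1 + logStar n +_) (regroup 15 factor 48 (y + 1)) ⟩
  1 + logStar n + 15 * (factor * 48) * (y + 1)     ≤⟨ ≤-slack (144 * y + 143) (slack (logStar n) (15 * (factor * 48)) y) ⟩
  constant * (y + 1) + logStar n                   ∎
  where
  open ≤-Reasoning
  e = scale ⌈log₂ Δ ⌉
  y = r * ⌈log₂ Δ ⌉
  open Schedule e
  open PassSchedule e
  regroup : ∀ a f b x → a * (f * (b * x)) ≡ a * (f * b) * x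
  regroup a f b x = solve (a ∷ f ∷ b ∷ x ∷ [])
  slack : ∀ l f y → (144 + f) * (y + 1) + l ≡ 1 + l + f * (y + 1) + (144 * y + 143)
  slack l f y = solve (l ∷ f ∷ y ∷ [])

-- Stated for `suc t`, because the colour at time 0 is whatever the adversary wrote.
settled-colouring : ∀ n Δ (G : PortGraph n) → (∀ v → deg G v ≤ Δ) → ∀ (cfg : Config n) t →
  let open Schedule (scale ⌈log₂ Δ ⌉) ; open PassSchedule (scale ⌈log₂ Δ ⌉) in
  1 + levels n ⌈log₂ n ⌉ + duration Δ defects ≤ suc t →
  IsProperColoring G Δ (λ v → color algorithm (run algorithm G Δ (suc t) cfg v))
settled-colouring n Δ G deg≤Δ cfg t t≥ =
  (λ v → ≤-trans (≤-reflexive (color-state G Δ pal ids cfg t v)) (proj₁ proper′ v)) ,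
  λ u v adj same → proj₂ proper′ u v adj
    (trans (sym (color-state G Δ pal ids cfg t u)) (trans same (color-state G Δ pal ids cfg t v)))
  where
  open Schedule (scale ⌈log₂ Δ ⌉)
  open PassSchedule (scale ⌈log₂ Δ ⌉)
  Δ≤ : Δ ≤ 2 ^ (4 * scale ⌈log₂ Δ ⌉)
  Δ≤ = ≤-trans (n≤2^⌈log₂n⌉ Δ) (2^-mono-≤ (ℓ≤4scale ⌈log₂ Δ ⌉))
  pal : Δ < 2 ^ ρ * 2 ^ suc ρ
  pal = palette Δ≤
  ids : n ≤ 2 ^ ⌈log₂ n ⌉
  ids = n≤2^⌈log₂n⌉ n
  proper′ : IsProperColoring G Δ (λ v → Protocol.colour Δ (parameters n Δ) (state G Δ cfg (suc t) v))
  proper′ = Protocol.protocol-correct Δ (parameters n Δ) G deg≤Δ pal ids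
    (λ b v → stage-few b (≤-trans (deg≤Δ v) Δ≤))
    (capacity-τ (levels-reach n)) (capacity-ρ (levels-reach n)) (feasible Δ≤) (complete Δ)
    (state G Δ cfg) (state-obeys G Δ pal ids cfg) (suc t) t≥

colouring : ∀ n Δ (G : PortGraph n) → HasMaxDegree G Δ → ∀ (cfg : Config n) (r : ℕ) → Δ ^ 3 ≤ r ^ 4 →
  ∀ (t : ℕ) → constant * (r * ⌈log₂ Δ ⌉ + 1) + logStar n ≤ t →
  IsProperColoring G Δ (λ v → color algorithm (run algorithm G Δ t cfg v))
-- Time 0 never satisfies the bound, which is at least 1 by `enough-time`.
colouring n Δ G (deg≤Δ , _) cfg r Δ³≤r⁴ zero    t≥ = contradiction (≤-trans (enough-time n Δ r Δ³≤r⁴) t≥) λ ()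
colouring n Δ G (deg≤Δ , _) cfg r Δ³≤r⁴ (suc t) t≥ = settled-colouring n Δ G deg≤Δ cfg t (≤-trans (enough-time n Δ r Δ³≤r⁴) t≥)

theorem1p4 : ∃ λ (A : Algorithm) → ∃ λ (c : ℕ) →
    ∀ (n Δ : ℕ) (G : PortGraph n) → HasMaxDegree G Δ →
    (∀ (cfg : Config n) (t : ℕ) v i →
    length (outMsg A G Δ (run A G Δ t cfg) v i) ≤ c * (⌈log₂ n ⌉ + 1))
    ×
    (∀ (cfg : Config n) (r : ℕ) → Δ ^ 3 ≤ r ^ 4 →
    ∀ (t : ℕ) → c * (r * ⌈log₂ Δ ⌉ + 1) + logStar n ≤ t →
    IsProperColoring G Δ (λ v → color A (run A G Δ t cfg v)))
theorem1p4 = algorithm , constant , λ n Δ G maxDeg → messages n Δ G maxDeg , colouring n Δ G maxDeg
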